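{- Let $A$ be a finite totally ordered alphabet and let $w\in A^*$ be a primitive word. The following conditions are equivalent: (i) $w$ is a perfectly clustering Lyndon word; (ii) $w$ is a product of two palindromes and $w$ has a palindromic special factorization; (iii) $w$ has a special factorization $w=a_1\pi_1a_2\pi_2\cdots\pi_{k-1}a_k$ such that $w$ is conjugate to the word $W=a_k\pi_{k-1}a_{k-1}\cdots\pi_2a_2\pi_1a_1$.
   Context: For a word $w$, $Alph(w)$ is the set of letters occurring in $w$ and $|w|_a$ the number of occurrences of the letter $a$. A word is primitive if it is not a power $z^n$ with $n\geq 2$. Two words $u,v$ are conjugate if $u=xy$, $v=yx$ for some words $x,y$. Words are compared in the lexicographic order induced by the order on $A$ (a proper prefix is smaller). A Lyndon word is a primitive word which is strictly smaller lexicographically than all its other conjugates. A palindrome is a word equal to its reversal; a product of two palindromes means $w=pq$ with $p,q$ palindromes (possibly empty). For a primitive word $v$ of length $n$, let $v_1<v_2<\cdots<v_n$ be its conjugates in lexicographic order and $l_i$ the last letter of $v_i$; the Burrows–Wheeler transform of $v$ is $\mathrm{bw}(v)=l_1\cdots l_n$. Writing $A=\{b_1<\cdots<b_r\}$, the primitive word $v$ is perfectly clustering if $\mathrm{bw}(v)=b_r^{|v|_{b_r}}b_{r-1}^{|v|_{b_{r-1}}}\cdots b_1^{|v|_{b_1}}$, i.e. $\mathrm{bw}(v)$ is weakly decreasing. A special factorization of $w$ is a factorization $w=a_1\pi_1a_2\pi_2\cdots\pi_{k-1}a_k$ where $Alph(w)=\{a_1<a_2<\cdots<a_k\}$ and $\pi_1,\ldots,\pi_{k-1}\in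 A^*$. It is called palindromic if every $\pi_i$ is a palindrome. -}

module Defs where

open import Data.Nat using (ℕ; zero; suc; _≥_)
open import Data.Bool using (Bool; true; false; if_then_else_)
open import Data.Fin using (Fin; _<_; _≟_; _<?_)
open import Data.List using (List; []; _∷_; _++_; [_]; map; concat; concatMap; replicate;
  reverse; length; filter; drop; take; upTo; foldr; allFin)
open import Data.List.Membership.Propositional using (_∈_)
open import Data.List.Relation.Unary.Linked using (Linked)
open import Data.Product using (Σ; ∃; _×_; _,_; proj₂)
open import Relation.Binary.PropositionalEquality using (_≡_; _≢_; refl)
open import Relation.Nullary using (¬_; Dec; yes; no)
open import Function.Bundles using (_⇔_)

-- The finite totally ordered alphabet A = {b_1 < ... < b_r} is modelled by Fin r
-- with its natural order (every finite total order is isomorphic to one of these).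
Word : ℕ → Set
Word r = List (Fin r)

module _ {r : ℕ} where

  data _<lex_ : Word r → Word r → Set where
    []<∷  : ∀ {b v} → [] <lex (b ∷ v)
    here  : ∀ {a b u v} → a < b → (a ∷ u) <lex (b ∷ v)
    there : ∀ {a u v} → u <lex v → (a ∷ u) <lex (a ∷ v)

  lexb : Word r → Word r → Bool
  lexb [] [] = false
  lexb [] (_ ∷ _) = true
  lexb (_ ∷ _) [] = false
  lexb (a ∷ u) (b ∷ v) with a <? b
  ... | yes _ = true
  ... | no _ with a ≟ b
  ...   | yes _ = lexb u v
  ...   | no _ = false

  insertLex : Word r → List (Word r) → List (Word r)
  insertLex x [] = [ x ]
  insertLex x (y ∷ ys) = if lexb x y then x ∷ y ∷ ys else y ∷ insertLex x ys

  sortLex : List (Word r) → List (Word r)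
  sortLex = foldr insertLex []

  _^w_ : Word r → ℕ → Word r
  z ^w n = concat (replicate n z)

  Primitive : Word r → Set
  Primitive w = ¬ (Σ (Word r) λ z → Σ ℕ λ n → n ≥ 2 × w ≡ z ^w n)

  Conjugate : Word r → Word r → Set
  Conjugate u v = Σ (Word r) λ x → Σ (Word r) λ y → u ≡ x ++ y × v ≡ y ++ x

  Lyndon : Word r → Set
  Lyndon w = Primitive w × (∀ v → Conjugate w v → v ≢ w → w <lex v)

  Palindrome : Word r → Set
  Palindrome p = reverse p ≡ p

  ProductOfTwoPalindromes : Word r → Set
  ProductOfTwoPalindromes w =
    Σ (Word r) λ p → Σ (Word r) λ q → Palindrome p × Palindrome q × w ≡ p ++ q

  count : Fin r → Word r → ℕ
  count a w = length (filter (_≟ a) w)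

  rotations : Word r → List (Word r)
  rotations v = map (λ i → drop i v ++ take i v) (upTo (length v))

  lastL : Word r → Word r
  lastL [] = []
  lastL (x ∷ []) = [ x ]
  lastL (_ ∷ y ∷ ys) = lastL (y ∷ ys)

  bw : Word r → Word r
  bw v = concatMap lastL (sortLex (rotations v))

  PerfectlyClustering : Word r → Set
  PerfectlyClustering v =
    Primitive v × bw v ≡ concatMap (λ b → replicate (count b v) b) (reverse (allFin r))

  -- A factorization  a_1 π_1 a_2 π_2 ... π_{k-1} a_k  is given by a_1 and the list
  -- ((π_1 , a_2) , ... , (π_{k-1} , a_k)).
  Factor : Set
  Factor = Word r × Fin r

  letters : Fin r → List Factor → List (Fin r)
  letters a₁ rest = a₁ ∷ map proj₂ rest

  assemble : Fin r → List Factor → Word r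
  assemble a₁ rest = a₁ ∷ concatMap (λ { (π , a) → π ++ [ a ] }) rest

  reversedW : Word r → List Factor → Word r
  reversedW acc [] = acc
  reversedW acc ((π , a) ∷ rest) = reversedW (a ∷ π ++ acc) rest

  assembleRev : Fin r → List Factor → Word r
  assembleRev a₁ rest = reversedW [ a₁ ] rest

  IsSpecial : Word r → Fin r → List Factor → Set
  IsSpecial w a₁ rest =
    w ≡ assemble a₁ rest
    × Linked _<_ (letters a₁ rest)
    × (∀ c → (c ∈ w) ⇔ (c ∈ letters a₁ rest))

  HasPalindromicSpecialFactorization : Word r → Set
  HasPalindromicSpecialFactorization w =
    Σ (Fin r) λ a₁ → Σ (List Factor) λ rest →
      IsSpecial w a₁ rest × (∀ {π a} → (π , a) ∈ rest → Palindrome π)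

  HasConjugateReversedSpecialFactorization : Word r → Set
  HasConjugateReversedSpecialFactorization w =
    Σ (Fin r) λ a₁ → Σ (List Factor) λ rest →
      IsSpecial w a₁ rest × Conjugate w (assembleRev a₁ rest)

{-# OPTIONS --safe #-}

-- Rank the n rotations of a primitive word lexicographically. The word is perfectly clustering exactly
-- when passing to the next rotation acts on ranks as the discrete interval exchange T that reverses the
-- order of the blocks of ranks, one block per first letter. Then T = R ∘ ι, where R flips all ranks and
-- ι flips each block, and ι preserves first letters: reading the orbit backwards makes the word a product
-- of two palindromes. Follow a boundary between two adjacent blocks under the two flips. The chain of
-- boundaries so obtained spells the letters between two consecutive a_i from both ends, so these form a
-- palindrome once the chain meets itself. If it did not, it would be a set of boundaries invariant under
-- both flips without fixed boundary, and the parity of the number of its elements on the left of a rank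
-- would be invariant under T, hence constant, which is absurd.
-- Conversely, W arises from w by reversing the order of the blocks π_m a_{m+1} and replacing in each the
-- final letter by a_m. As W is a rotation of w, this sends every position of w but the first
-- to one whose rotation is smaller and whose preceding letter is at least as large. It is injective, so it
-- is the predecessor map on ranks: the first rotation is the least one, and last letters decrease.
module Submission where

open import Defs
open import Data.Bool using (Bool; true; false; _xor_)
import Data.Bool.Properties as B
open import Data.Empty using (⊥-elim)
open import Data.Fin as F using (Fin; _≟_; _<?_; toℕ; fromℕ<)
import Data.Fin.Properties as F
open import Data.List using (List; []; _∷_; _++_; [_]; map; concatMap; replicate; reverse; length;
  allFin; applyUpTo; applyDownFrom; upTo; take; drop)
import Data.List.Properties as L
open import Data.List.Membership.Propositional using (_∈_)
open import Data.List.Membership.Propositional.Properties using (∈-allFin; ∈-applyUpTo⁺; ∈-applyUpTo⁻)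
open import Data.List.Relation.Binary.Permutation.Propositional
  using (_↭_; ↭-refl; ↭-sym; ↭-trans; prep; swap; ↭-reflexive; ↭⇒↭ₛ)
import Data.List.Relation.Binary.Permutation.Propositional.Properties as ↭
open import Data.List.Relation.Binary.Pointwise using (Pointwise-≡⇒≡)
open import Data.List.Relation.Unary.All as All using (All; []; _∷_)
import Data.List.Relation.Unary.All.Properties as All
open import Data.List.Relation.Unary.AllPairs as AllPairs using (AllPairs; []; _∷_)
import Data.List.Relation.Unary.AllPairs.Properties as AllPairs
open import Data.List.Relation.Unary.Any using (here; there)
import Data.List.Relation.Unary.Any.Properties as Any
open import Data.List.Relation.Unary.Linked using (Linked; [-]; _∷_)
open import Data.List.Relation.Unary.Sorted.TotalOrder.Properties using (AllPairs⇒Sorted; ↗↭↗⇒≋)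
open import Data.List.Relation.Unary.Unique.Propositional using (Unique)
open import Data.Nat using (ℕ; zero; suc; _+_; _*_; _∸_; _≤_; _<_; z≤n; s≤s; _%_; _/_; _⊓_)
import Data.Nat.DivMod as ℕ
open import Data.Nat.Induction using (<-wellFounded)
import Data.Nat.Properties as ℕ
open import Data.Nat.Tactic.RingSolver using (solve-∀)
open import Data.Product using (∃; ∃₂; _×_; _,_; proj₁; proj₂)
open import Data.Sum using (_⊎_; inj₁; inj₂)
open import Data.Unit using (tt)
open import Function using (_∘_; id; flip)
open import Function.Bundles using (_⇔_; mk⇔)
open import Induction.WellFounded using (Acc; acc)
open import Relation.Binary using (tri<; tri≈; tri>)
import Relation.Binary.Construct.Flip.EqAndOrd as Flip
open import Relation.Binary.PropositionalEquality
  using (_≡_; _≢_; refl; sym; trans; cong; cong₂; subst; subst₂; module ≡-Reasoning)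
open import Relation.Nullary using (¬_; Dec; yes; no; does)
open import Relation.Nullary.Decidable using (_⊎-dec_; dec-true; dec-false; does-⇔)

-- Lexicographic order and the Burrows–Wheeler transform

module _ {r : ℕ} where

  <lex-irrefl : ∀ {u : Word r} → ¬ u <lex u
  <lex-irrefl (here a<a) = F.<-irrefl refl a<a
  <lex-irrefl (there p)  = <lex-irrefl p

  <lex-trans : ∀ {u v w : Word r} → u <lex v → v <lex w → u <lex w
  <lex-trans []<∷      (here _)  = []<∷
  <lex-trans []<∷      (there _) = []<∷
  <lex-trans (here p)  (here q)  = here (F.<-trans p q)
  <lex-trans (here p)  (there _) = here p
  <lex-trans (there _) (here q)  = here q
  <lex-trans (there p) (there q) = there (<lex-trans p q)

  <lex-asym : ∀ {u v : Word r} → u <lex v → ¬ v <lex u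
  <lex-asym p q = <lex-irrefl (<lex-trans p q)

  <lex-connected : ∀ (u v : Word r) → u ≡ v ⊎ u <lex v ⊎ v <lex u
  <lex-connected []      []      = inj₁ refl
  <lex-connected []      (_ ∷ _) = inj₂ (inj₁ []<∷)
  <lex-connected (_ ∷ _) []      = inj₂ (inj₂ []<∷)
  <lex-connected (a ∷ u) (b ∷ v) with F.<-cmp a b
  ... | tri< a<b _ _ = inj₂ (inj₁ (here a<b))
  ... | tri> _ _ b<a = inj₂ (inj₂ (here b<a))
  ... | tri≈ _ refl _ with <lex-connected u v
  ...   | inj₁ refl     = inj₁ refl
  ...   | inj₂ (inj₁ p) = inj₂ (inj₁ (there p))
  ...   | inj₂ (inj₂ p) = inj₂ (inj₂ (there p))

  <lex-∷⁻ : ∀ {a b} {u v : Word r} → (a ∷ u) <lex (b ∷ v) → a F.< b ⊎ (a ≡ b × u <lex v)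
  <lex-∷⁻ (here p)  = inj₁ p
  <lex-∷⁻ (there p) = inj₂ (refl , p)

  abstract
    _<lex?_ : ∀ (u v : Word r) → Dec (u <lex v)
    u <lex? v with <lex-connected u v
    ... | inj₁ refl     = no <lex-irrefl
    ... | inj₂ (inj₁ p) = yes p
    ... | inj₂ (inj₂ p) = no (<lex-asym p)

  lexb-complete : ∀ {u v : Word r} → u <lex v → lexb u v ≡ true
  lexb-complete []<∷ = refl
  lexb-complete {a ∷ _} {b ∷ _} (here a<b) with a <? b
  ... | yes _   = refl
  ... | no  a≮b = ⊥-elim (a≮b a<b)
  lexb-complete {a ∷ _} (there p) with a <? a
  ... | yes _ = refl
  ... | no  _ with a ≟ a
  ...   | yes _   = lexb-complete p
  ...   | no  a≢a = ⊥-elim (a≢a refl)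

  lexb-sound : ∀ (u v : Word r) → lexb u v ≡ true → u <lex v
  lexb-sound []      (_ ∷ _) _ = []<∷
  lexb-sound (a ∷ u) (b ∷ v) p with a <? b
  ... | yes a<b = here a<b
  ... | no  _ with a ≟ b
  ...   | yes refl = there (lexb-sound u v p)
  lexb-sound (a ∷ u) (b ∷ v) () | no _ | no _

  insertLex-↭ : ∀ (x : Word r) ys → insertLex x ys ↭ x ∷ ys
  insertLex-↭ x []       = ↭-refl
  insertLex-↭ x (y ∷ ys) with lexb x y
  ... | true  = ↭-refl
  ... | false = ↭-trans (prep y (insertLex-↭ x ys)) (swap y x ↭-refl)

  sortLex-↭ : ∀ (xs : List (Word r)) → sortLex xs ↭ xs
  sortLex-↭ []       = ↭-refl
  sortLex-↭ (x ∷ xs) = ↭-trans (insertLex-↭ x (sortLex xs)) (prep x (sortLex-↭ xs))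

  _≯lex_ : Word r → Word r → Set
  u ≯lex v = ¬ v <lex u

  insertLex-sorted : ∀ x {ys} → AllPairs _≯lex_ ys → AllPairs _≯lex_ (insertLex x ys)
  insertLex-sorted x []                     = [] ∷ []
  insertLex-sorted x {y ∷ ys} (y≤ys ∷ ys↗) with lexb x y in eq
  ... | true  = (<lex-asym x<y ∷ All.map (λ y≤z z<x → y≤z (<lex-trans z<x x<y)) y≤ys) ∷ y≤ys ∷ ys↗
    where x<y = lexb-sound x y eq
  ... | false = ↭.All-resp-↭ (↭-sym (insertLex-↭ x ys)) (x≮y ∷ y≤ys) ∷ insertLex-sorted x ys↗
    where
    x≮y : y ≯lex x
    x≮y x<y with () ← trans (sym eq) (lexb-complete x<y)

  sortLex-sorted : ∀ xs → AllPairs _≯lex_ (sortLex xs)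
  sortLex-sorted []       = []
  sortLex-sorted (x ∷ xs) = insertLex-sorted x (sortLex-sorted xs)

  -- The word prescribed by `PerfectlyClustering`, with the list of letters left free for induction.
  replicates : List (Fin r) → Word r → Word r
  replicates bs v = concatMap (λ b → replicate (count b v) b) bs

  count-hit : ∀ (b : Fin r) v → count b (b ∷ v) ≡ suc (count b v)
  count-hit b v = cong length (L.filter-accept (_≟ b) refl)

  count-miss : ∀ {b x : Fin r} v → x ≢ b → count b (x ∷ v) ≡ count b v
  count-miss v x≢b = cong length (L.filter-reject (_≟ _) x≢b)

  replicates-miss : ∀ {x} v {bs} → All (x ≢_) bs → replicates bs (x ∷ v) ≡ replicates bs v
  replicates-miss v []             = refl
  replicates-miss v {b ∷ _} (x≢b ∷ x∉bs) =
    cong₂ _++_ (cong (λ k → replicate k b) (count-miss v x≢b)) (replicates-miss v x∉bs)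

  replicates-∷ : ∀ x v {bs} → Unique bs → x ∈ bs → replicates bs (x ∷ v) ↭ x ∷ replicates bs v
  replicates-∷ x v {b ∷ bs} (x∉bs ∷ _) (here refl) = ↭-reflexive (cong₂ _++_
    (cong (λ k → replicate k x) (count-hit x v)) (replicates-miss v x∉bs))
  replicates-∷ x v {b ∷ bs} (b∉bs ∷ bs!) (there x∈bs) = ↭-trans
    (↭.++⁺ (↭-reflexive (cong (λ k → replicate k b) (count-miss v (All.lookup b∉bs x∈bs ∘ sym))))
      (replicates-∷ x v bs! x∈bs))
    (↭.shift x (replicate (count b v) b) (replicates bs v))

  replicates-[] : ∀ bs → replicates bs [] ≡ []
  replicates-[] []       = refl
  replicates-[] (_ ∷ bs) = replicates-[] bs

  replicates-↭ : ∀ {bs} → Unique bs → (∀ x → x ∈ bs) → ∀ v → replicates bs v ↭ v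
  replicates-↭ {bs} bs! all []  = ↭-reflexive (replicates-[] bs)
  replicates-↭ bs! all (x ∷ v) =
    ↭-trans (replicates-∷ x v bs! (all x)) (prep x (replicates-↭ bs! all v))

  Decreasing : Word r → Set
  Decreasing = AllPairs F._≥_

  replicate-decreasing : ∀ k b → Decreasing (replicate k b)
  replicate-decreasing zero    b = []
  replicate-decreasing (suc k) b = All.replicate⁺ k F.≤-refl ∷ replicate-decreasing k b

  All-replicates : ∀ {P : Fin r → Set} v {bs} → All P bs → All P (replicates bs v)
  All-replicates v []       = []
  All-replicates v {b ∷ _} (p ∷ ps) = All.++⁺ (All.replicate⁺ (count b v) p) (All-replicates v ps)

  replicates-decreasing : ∀ v {bs} → AllPairs F._>_ bs → Decreasing (replicates bs v)
  replicates-decreasing v []                    = []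
  replicates-decreasing v {b ∷ _} (b>bs ∷ bs↘) = AllPairs.++⁺ (replicate-decreasing (count b v) b)
    (replicates-decreasing v bs↘)
    (All.replicate⁺ (count b v) (All-replicates v (All.map ℕ.<⇒≤ b>bs)))

  AllPairs-reverse : ∀ {A : Set} {R : A → A → Set} {xs} → AllPairs R xs → AllPairs (flip R) (reverse xs)
  AllPairs-reverse []                   = []
  AllPairs-reverse {R = R} {x ∷ xs} (px ∷ pxs) = subst (AllPairs (flip R)) (sym (L.unfold-reverse x xs))
    (AllPairs.++⁺ (AllPairs-reverse pxs) ([] ∷ [])
      (All.map (λ p → p ∷ []) (↭.All-resp-↭ (↭-sym (↭.↭-reverse xs)) px)))

  alphabet↓ : List (Fin r)
  alphabet↓ = reverse (allFin r)

  alphabet↓-decreasing : AllPairs F._>_ alphabet↓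
  alphabet↓-decreasing = AllPairs-reverse (AllPairs.tabulate⁺-< id)

  alphabet↓-unique : Unique alphabet↓
  alphabet↓-unique = AllPairs.map (λ p q → F.<-irrefl (sym q) p) alphabet↓-decreasing

  alphabet↓-complete : ∀ x → x ∈ alphabet↓
  alphabet↓-complete x = Any.reverse⁺ (∈-allFin x)

  -- Both words are sorted for the reversed order of letters, and a sorted word is determined by its
  -- multiset of letters.
  decreasing⇒replicates : ∀ {u v} → Decreasing u → u ↭ v → u ≡ replicates alphabet↓ v
  decreasing⇒replicates {u} {v} u↘ u↭v = Pointwise-≡⇒≡ (↗↭↗⇒≋ ≥-order
    (AllPairs⇒Sorted ≥-order u↘)
    (AllPairs⇒Sorted ≥-order (replicates-decreasing v alphabet↓-decreasing))
    (↭⇒↭ₛ (↭-trans u↭v (↭-sym (replicates-↭ alphabet↓-unique alphabet↓-complete v)))))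
    where ≥-order = Flip.totalOrder (F.≤-totalOrder r)

  AllPairs-∈ : ∀ {A : Set} {R : A → A → Set} {xs} → AllPairs R xs →
    ∀ {x y} → x ∈ xs → y ∈ xs → x ≡ y ⊎ R x y ⊎ R y x
  AllPairs-∈ (px ∷ pxs) (here refl) (here refl) = inj₁ refl
  AllPairs-∈ (px ∷ pxs) (here refl) (there q)   = inj₂ (inj₁ (All.lookup px q))
  AllPairs-∈ (px ∷ pxs) (there p)   (here refl) = inj₂ (inj₂ (All.lookup px p))
  AllPairs-∈ (px ∷ pxs) (there p)   (there q)   = AllPairs-∈ pxs p q

  AllPairs-zip∈ : ∀ {A : Set} {R S : A → A → Set} {xs} →
    (∀ {x y} → x ∈ xs → y ∈ xs → R x y → S x y) → AllPairs R xs → AllPairs S xs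
  AllPairs-zip∈ f []         = []
  AllPairs-zip∈ f (px ∷ pxs) =
    All.tabulate (λ y∈ → f (here refl) (there y∈) (All.lookup px y∈)) ∷
    AllPairs-zip∈ (λ p q → f (there p) (there q)) pxs

  -- A total form of the last letter; the default `d` is returned only for the empty word, which is
  -- never a rotation here.
  lastOr : Fin r → Word r → Fin r
  lastOr d []      = d
  lastOr _ (x ∷ u) = lastOr x u

  lastL-∷ : ∀ x u → lastL (x ∷ u) ≡ [ lastOr x u ]
  lastL-∷ x []      = refl
  lastL-∷ x (y ∷ u) = lastL-∷ y u

  concatMap-lastL : ∀ d {us} → All (_≢ []) us → concatMap lastL us ≡ map (lastOr d) us
  concatMap-lastL d []                    = refl
  concatMap-lastL d {[]    ∷ _} (ne ∷ _)  = ⊥-elim (ne refl)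
  concatMap-lastL d {(x ∷ u) ∷ _} (_ ∷ nes) = cong₂ _++_ (lastL-∷ x u) (concatMap-lastL d nes)

  -- The intrinsic form of perfect clustering: along the rotations in lexicographic order,
  -- the last letters decrease weakly.
  module Clustering (d : Fin r) (w : Word r) (nonempty : All (_≢ []) (rotations w)) where

    bw≡ : bw w ≡ map (lastOr d) (sortLex (rotations w))
    bw≡ = concatMap-lastL d (↭.All-resp-↭ (↭-sym (sortLex-↭ (rotations w))) nonempty)

    -- Along the sorted list the rotations increase and, by the shape of `bw w`, their last letters
    -- decrease. Since `u <lex v`, no occurrence of `v` can precede one of `u`.
    bw⇒antitone : bw w ≡ replicates alphabet↓ w →
      ∀ {u v} → u ∈ rotations w → v ∈ rotations w → u <lex v → lastOr d v F.≤ lastOr d u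
    bw⇒antitone canonical {u} {v} u∈ v∈ u<v
      with AllPairs-∈ both (resort u∈) (resort v∈)
      where
      resort : ∀ {x} → x ∈ rotations w → x ∈ sortLex (rotations w)
      resort = ↭.∈-resp-↭ (↭-sym (sortLex-↭ (rotations w)))
      both = AllPairs.zip (sortLex-sorted (rotations w) , AllPairs.map⁻ (subst Decreasing
        (trans (sym canonical) bw≡) (replicates-decreasing w alphabet↓-decreasing)))
    ... | inj₁ refl               = ℕ.≤-refl
    ... | inj₂ (inj₁ (_ , v≤u))   = v≤u
    ... | inj₂ (inj₂ (u≮v , _))   = ⊥-elim (u≮v u<v)

    antitone⇒bw : map (lastOr d) (rotations w) ↭ w →
      (∀ {u v} → u ∈ rotations w → v ∈ rotations w → u <lex v → lastOr d v F.≤ lastOr d u) →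
      bw w ≡ replicates alphabet↓ w
    antitone⇒bw lasts↭ antitone = decreasing⇒replicates
      (subst Decreasing (sym bw≡) (AllPairs.map⁺ (AllPairs-zip∈ step (sortLex-sorted (rotations w)))))
      (↭-trans (↭-reflexive bw≡) (↭-trans (↭.map⁺ (lastOr d) (sortLex-↭ (rotations w))) lasts↭))
      where
      step : ∀ {u v} → u ∈ sortLex (rotations w) → v ∈ sortLex (rotations w) →
        ¬ v <lex u → lastOr d v F.≤ lastOr d u
      step {u} {v} u∈ v∈ v≮u with <lex-connected u v
      ... | inj₁ refl       = ℕ.≤-refl
      ... | inj₂ (inj₁ u<v) = antitone (↭.∈-resp-↭ (sortLex-↭ (rotations w)) u∈)
                                       (↭.∈-resp-↭ (sortLex-↭ (rotations w)) v∈) u<v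
      ... | inj₂ (inj₂ v<u) = ⊥-elim (v≮u v<u)

-- Rotations of a primitive word and their ranks

module _ {A : Set} where

  -- Levi's lemma for the free monoid.
  ++-levi : ∀ (x z : List A) {y w} → x ++ y ≡ z ++ w →
    (∃ λ s → x ≡ z ++ s × s ++ y ≡ w) ⊎ (∃ λ s → z ≡ x ++ s × y ≡ s ++ w)
  ++-levi x       []      eq = inj₁ (x , refl , eq)
  ++-levi []      (z ∷ zs) eq = inj₂ (z ∷ zs , refl , eq)
  ++-levi (x ∷ xs) (z ∷ zs) eq with L.∷-injective eq
  ... | refl , eq′ with ++-levi xs zs eq′
  ...   | inj₁ (s , p , q) = inj₁ (s , cong (x ∷_) p , q)
  ...   | inj₂ (s , p , q) = inj₂ (s , cong (x ∷_) p , q)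

  applyUpTo-cong : ∀ {f g : ℕ → A} k → (∀ {i} → i < k → f i ≡ g i) → applyUpTo f k ≡ applyUpTo g k
  applyUpTo-cong zero    eq = refl
  applyUpTo-cong (suc k) eq = cong₂ _∷_ (eq (s≤s z≤n)) (applyUpTo-cong k (λ i<k → eq (s≤s i<k)))

module _ {r : ℕ} where

  ^w-+ : ∀ (z : Word r) a b → z ^w (a + b) ≡ (z ^w a) ++ (z ^w b)
  ^w-+ z zero    b = refl
  ^w-+ z (suc a) b = trans (cong (z ++_) (^w-+ z a b)) (sym (L.++-assoc z (z ^w a) (z ^w b)))

  -- Euclid's algorithm on lengths: the shorter word is a prefix of the longer one, and removing it
  -- leaves a commuting pair of smaller total length.
  commuting⇒powers : ∀ (u v : Word r) → u ≢ [] → v ≢ [] → u ++ v ≡ v ++ u →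
    ∃ λ z → ∃₂ λ a b → u ≡ z ^w suc a × v ≡ z ^w suc b
  commuting⇒powers u v = go u v (<-wellFounded (length u + length v))
    where
    nonempty-length : ∀ (v : Word r) → v ≢ [] → 0 < length v
    nonempty-length []      v≢[] = ⊥-elim (v≢[] refl)
    nonempty-length (_ ∷ _) _    = s≤s z≤n

    go : ∀ u v → Acc _<_ (length u + length v) → u ≢ [] → v ≢ [] → u ++ v ≡ v ++ u →
      ∃ λ z → ∃₂ λ a b → u ≡ z ^w suc a × v ≡ z ^w suc b
    go u v (acc rs) u≢[] v≢[] eq with ++-levi u v eq
    ... | inj₁ ([] , refl , _) = v , 0 , 0 , refl , sym (L.++-identityʳ v)
    ... | inj₁ (s@(_ ∷ _) , refl , sv≡vs)
      with go s v (rs (ℕ.+-monoˡ-< (length v) (subst (length s <_) (sym (L.length-++ v))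
             (ℕ.m<n+m (length s) (nonempty-length v v≢[]))))) (λ ()) v≢[] sv≡vs
    ...   | z , a , b , p , q = z , b + suc a , b ,
              trans (cong₂ _++_ q p) (sym (^w-+ z (suc b) (suc a))) , q
    go u v (acc rs) u≢[] v≢[] eq | inj₂ ([] , refl , _) =
      u , 0 , 0 , sym (L.++-identityʳ u) , cong (u ++_) refl
    go u v (acc rs) u≢[] v≢[] eq | inj₂ (s@(_ ∷ _) , refl , us≡su)
      with go u s (rs (ℕ.+-monoʳ-< (length u) (subst (length s <_) (sym (L.length-++ u))
             (ℕ.m<n+m (length s) (nonempty-length u u≢[]))))) u≢[] (λ ()) us≡su
    ...   | z , a , b , p , q = z , a , a + suc b , p ,
              trans (cong₂ _++_ p q) (sym (^w-+ z (suc a) (suc b)))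

  primitive⇒¬commuting : ∀ (u v : Word r) → Primitive (u ++ v) → u ≢ [] → v ≢ [] → u ++ v ≢ v ++ u
  primitive⇒¬commuting u v prim u≢[] v≢[] eq with commuting⇒powers u v u≢[] v≢[] eq
  ... | z , a , b , p , q = prim (z , suc a + suc b , s≤s (ℕ.m≤n⇒m≤o+n a (s≤s z≤n)) ,
    trans (cong₂ _++_ p q) (sym (^w-+ z (suc a) (suc b))))

  -- Equal lengths exclude a proper prefix, so the comparison is decided before the appended
  -- letters, which may differ.
  <lex-∷ʳ⁺ : ∀ {u v : Word r} {a b} → length u ≡ length v → u <lex v → (u ++ [ a ]) <lex (v ++ [ b ])
  <lex-∷ʳ⁺ eq (here p)  = here p
  <lex-∷ʳ⁺ eq (there p) = there (<lex-∷ʳ⁺ (ℕ.suc-injective eq) p)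

  <lex-∷ʳ⁻ : ∀ (u v : Word r) {a} → length u ≡ length v → (u ++ [ a ]) <lex (v ++ [ a ]) → u <lex v
  <lex-∷ʳ⁻ []      []      eq p         = ⊥-elim (<lex-irrefl p)
  <lex-∷ʳ⁻ (_ ∷ u) (_ ∷ v) eq (here p)  = here p
  <lex-∷ʳ⁻ (_ ∷ u) (_ ∷ v) eq (there p) = there (<lex-∷ʳ⁻ u v (ℕ.suc-injective eq) p)

-- Finite sums and counting by indicators

abstract

  Σ< : ℕ → (ℕ → ℕ) → ℕ
  Σ< zero    f = 0
  Σ< (suc n) f = f n + Σ< n f

  Σ<-cong : ∀ n {f g} → (∀ i → f i ≡ g i) → Σ< n f ≡ Σ< n g
  Σ<-cong zero    eq = refl
  Σ<-cong (suc n) eq = cong₂ _+_ (eq n) (Σ<-cong n eq)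

  Σ<-+ : ∀ n f g → Σ< n (λ i → f i + g i) ≡ Σ< n f + Σ< n g
  Σ<-+ zero    f g = refl
  Σ<-+ (suc n) f g = trans (cong (f n + g n +_) (Σ<-+ n f g)) (interchange (f n) (g n) (Σ< n f) (Σ< n g))
    where
    interchange : ∀ a b c d → a + b + (c + d) ≡ a + c + (b + d)
    interchange = solve-∀

  Σ<-mono-≤ : ∀ n {f g} → (∀ i → f i ≤ g i) → Σ< n f ≤ Σ< n g
  Σ<-mono-≤ zero    le = z≤n
  Σ<-mono-≤ (suc n) le = ℕ.+-mono-≤ (le n) (Σ<-mono-≤ n le)

  Σ<-mono-< : ∀ n {f g} → (∀ i → f i ≤ g i) → ∀ {k} → k < n → f k < g k → Σ< n f < Σ< n g
  Σ<-mono-< (suc n) le {k} (s≤s k≤n) lt with k ℕ.≟ n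
  ... | yes refl = ℕ.+-mono-<-≤ lt (Σ<-mono-≤ n le)
  ... | no  k≢n  = ℕ.+-mono-≤-< (le n) (Σ<-mono-< n le (ℕ.≤∧≢⇒< k≤n k≢n) lt)

  -- Both sums arise from the sum of `suc n` terms by removing an end term, the first or the last,
  -- and these are equal.
  Σ<-shift : ∀ n f → f n ≡ f 0 → Σ< n (f ∘ suc) ≡ Σ< n f
  Σ<-shift n f eq = ℕ.+-cancelˡ-≡ (f 0) _ _ (trans (sym (head n)) (cong (_+ Σ< n f) eq))
    where
    +-swap : ∀ a b c → a + (b + c) ≡ b + (a + c)
    +-swap = solve-∀
    head : ∀ n → Σ< (suc n) f ≡ f 0 + Σ< n (f ∘ suc)
    head zero    = refl
    head (suc n) = trans (cong (f (suc n) +_) (head n)) (+-swap (f (suc n)) (f 0) _)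

  Σ<-const : ∀ n → Σ< n (λ _ → 1) ≡ n
  Σ<-const zero    = refl
  Σ<-const (suc n) = cong suc (Σ<-const n)

𝟙 : ∀ {P : Set} → Dec P → ℕ
𝟙 (yes _) = 1
𝟙 (no  _) = 0

𝟙-yes : ∀ {P : Set} (P? : Dec P) → P → 𝟙 P? ≡ 1
𝟙-yes (yes _) p = refl
𝟙-yes (no ¬p) p = ⊥-elim (¬p p)

𝟙-no : ∀ {P : Set} (P? : Dec P) → ¬ P → 𝟙 P? ≡ 0
𝟙-no (yes p) ¬p = ⊥-elim (¬p p)
𝟙-no (no _)  ¬p = refl

𝟙-mono : ∀ {P Q : Set} (P? : Dec P) (Q? : Dec Q) → (P → Q) → 𝟙 P? ≤ 𝟙 Q?
𝟙-mono (yes p) Q? f = ℕ.≤-reflexive (sym (𝟙-yes Q? (f p)))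
𝟙-mono (no _)  Q? f = z≤n

-- The word is `rot 0` for a sequence of period `n`. Rotations are then windows at arbitrary
-- indices, without reduction modulo `n`.
module Cyclic {r : ℕ} (m : ℕ) (W : ℕ → Fin r) (periodic : ∀ i → W (i + suc m) ≡ W i) where

  n : ℕ
  n = suc m

  win : ℕ → ℕ → Word r
  win j zero    = []
  win j (suc k) = W j ∷ win (suc j) k

  length-win : ∀ j k → length (win j k) ≡ k
  length-win j zero    = refl
  length-win j (suc k) = cong suc (length-win (suc j) k)

  win≡applyUpTo : ∀ j k → win j k ≡ applyUpTo (λ i → W (j + i)) k
  win≡applyUpTo j zero    = refl
  win≡applyUpTo j (suc k) = cong₂ _∷_ (cong W (sym (ℕ.+-identityʳ j)))
    (trans (win≡applyUpTo (suc j) k) (applyUpTo-cong k (λ {i} _ → cong W (sym (ℕ.+-suc j i)))))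

  win-++ : ∀ j a b → win j (a + b) ≡ win j a ++ win (j + a) b
  win-++ j zero    b = cong (λ j → win j b) (sym (ℕ.+-identityʳ j))
  win-++ j (suc a) b = cong (W j ∷_) (trans (win-++ (suc j) a b)
    (cong (λ i → win (suc j) a ++ win i b) (sym (ℕ.+-suc j a))))

  win-periodic : ∀ j k → win (j + n) k ≡ win j k
  win-periodic j zero    = refl
  win-periodic j (suc k) = cong₂ _∷_ (periodic j) (win-periodic (suc j) k)

  win-split : ∀ j k x {y} → x ++ y ≡ win j k → x ≡ win j (length x) × y ≡ win (j + length x) (length y)
  win-split j k       []      {y} eq rewrite ℕ.+-identityʳ j =
    refl , trans eq (cong (win j) (sym (trans (cong length eq) (length-win j k))))
  win-split j (suc k) (x ∷ xs) {y} eq with L.∷-injective eq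
  ... | refl , eq′ with win-split (suc j) k xs eq′
  ...   | p , q = cong (x ∷_) p , trans q (cong (λ i → win i (length y)) (sym (ℕ.+-suc j (length xs))))

  rot : ℕ → Word r
  rot j = win j n

  rot-periodic : ∀ j → rot (j + n) ≡ rot j
  rot-periodic j = win-periodic j n

  rot-suc : ∀ j → rot (suc j) ≡ win (suc j) m ++ [ W j ]
  rot-suc j = begin
    win (suc j) n                         ≡⟨ cong (win (suc j)) (ℕ.+-comm 1 m) ⟩
    win (suc j) (m + 1)                   ≡⟨ win-++ (suc j) m 1 ⟩
    win (suc j) m ++ [ W (suc j + m) ]    ≡⟨ cong (λ x → win (suc j) m ++ [ x ])
                                               (trans (cong W (sym (ℕ.+-suc j m))) (periodic j)) ⟩
    win (suc j) m ++ [ W j ]              ∎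
    where open ≡-Reasoning

  rot-conjugate : ∀ j x {y} → x ++ y ≡ rot j → y ++ x ≡ rot (j + length x)
  rot-conjugate j x {y} eq with win-split j n x eq
  ... | p , q = begin
    y ++ x                                                 ≡⟨ cong₂ _++_ q p ⟩
    win (j + ℓx) ℓy ++ win j ℓx                            ≡⟨ cong (win (j + ℓx) ℓy ++_) (sym (win-periodic j ℓx)) ⟩
    win (j + ℓx) ℓy ++ win (j + n) ℓx                      ≡⟨ cong (λ i → win (j + ℓx) ℓy ++ win i ℓx)
                                                               (trans (cong (j +_) (sym ℓ)) (sym (ℕ.+-assoc j ℓx ℓy))) ⟩
    win (j + ℓx) ℓy ++ win (j + ℓx + ℓy) ℓx                ≡⟨ sym (win-++ (j + ℓx) ℓy ℓx) ⟩
    win (j + ℓx) (ℓy + ℓx)                                 ≡⟨ cong (win (j + ℓx)) (trans (ℕ.+-comm ℓy ℓx) ℓ) ⟩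
    rot (j + ℓx)                                           ∎
    where
    open ≡-Reasoning
    ℓx = length x
    ℓy = length y
    ℓ : ℓx + ℓy ≡ n
    ℓ = trans (sym (L.length-++ x)) (trans (cong length eq) (length-win j n))

  rot0-cut : ∀ {d} → d ≤ n → rot 0 ≡ win 0 d ++ win d (n ∸ d)
  rot0-cut {d} d≤n = trans (cong (win 0) (sym (ℕ.m+[n∸m]≡n d≤n))) (win-++ 0 d (n ∸ d))

  rot-cut : ∀ {d} → d ≤ n → rot d ≡ win d (n ∸ d) ++ win 0 d
  rot-cut {d} d≤n = sym (trans (rot-conjugate 0 (win 0 d) (sym (rot0-cut d≤n))) (cong rot (length-win 0 d)))

  rotations-rot : rotations (rot 0) ≡ applyUpTo rot n
  rotations-rot = trans (cong (λ k → map (λ i → drop i (rot 0) ++ take i (rot 0)) (upTo k)) (length-win 0 n))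
    (trans (L.map-upTo _ n) (applyUpTo-cong n (λ {i} i<n →
      trans (rot-conjugate 0 (take i (rot 0)) (L.take++drop≡id i (rot 0)))
        (cong rot (trans (L.length-take i (rot 0)) (trans (cong (i ⊓_) (length-win 0 n))
          (ℕ.m≤n⇒m⊓n≡m (ℕ.<⇒≤ i<n))))))))

  rot-+* : ∀ i q → rot (i + q * n) ≡ rot i
  rot-+* i zero    = cong rot (ℕ.+-identityʳ i)
  rot-+* i (suc q) = trans
    (cong rot (trans (cong (i +_) (ℕ.+-comm n (q * n))) (sym (ℕ.+-assoc i (q * n) n))))
    (trans (rot-periodic (i + q * n)) (rot-+* i q))

  rot-% : ∀ j → rot (j % n) ≡ rot j
  rot-% j = trans (sym (rot-+* (j % n) (j / n))) (cong rot (sym (ℕ.m≡m%n+[m/n]*n j n)))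

  rot≡⇒W≡ : ∀ {i j} → rot i ≡ rot j → W i ≡ W j
  rot≡⇒W≡ = L.∷-injectiveˡ

  rot≡-suc : ∀ {i j} → rot i ≡ rot j → rot (suc i) ≡ rot (suc j)
  rot≡-suc {i} {j} eq = trans (rot-suc i) (trans
    (cong₂ (λ x a → x ++ [ a ]) (L.∷-injectiveʳ eq) (rot≡⇒W≡ {i} {j} eq)) (sym (rot-suc j)))

  rot≡-+ : ∀ {i j} → rot i ≡ rot j → ∀ k → rot (k + i) ≡ rot (k + j)
  rot≡-+ eq zero    = eq
  rot≡-+ {i} {j} eq (suc k) = rot≡-suc {k + i} {k + j} (rot≡-+ eq k)

  rot-≤-head : ∀ {i j} → rot i <lex rot j → W i F.≤ W j
  rot-≤-head p with <lex-∷⁻ p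
  ... | inj₁ lt       = ℕ.<⇒≤ lt
  ... | inj₂ (eq , _) = ℕ.≤-reflexive (cong toℕ eq)

  -- Passing to the next index moves the first letter to the end. When both rotations share that
  -- letter, the other `m` letters decide the order before and after.
  rot-<-suc : ∀ {i j} → W i ≡ W j → rot i <lex rot j → rot (suc i) <lex rot (suc j)
  rot-<-suc {i} {j} eq p with <lex-∷⁻ p
  ... | inj₁ lt      = ⊥-elim (F.<-irrefl eq lt)
  ... | inj₂ (_ , q) = subst₂ _<lex_ (sym (rot-suc i)) (sym (rot-suc j))
    (<lex-∷ʳ⁺ (trans (length-win _ m) (sym (length-win _ m))) q)

  rot-<-pred : ∀ {i j} → W i ≡ W j → rot (suc i) <lex rot (suc j) → rot i <lex rot j
  rot-<-pred {i} {j} eq p = subst (λ a → rot i <lex (a ∷ win (suc j) m)) eq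
    (there (<lex-∷ʳ⁻ _ _ (trans (length-win _ m) (sym (length-win _ m)))
      (subst₂ _<lex_ (rot-suc i) (trans (rot-suc j) (cong (λ a → win (suc j) m ++ [ a ]) (sym eq))) p)))

  rank : ℕ → ℕ
  rank j = Σ< n (λ i → 𝟙 (rot i <lex? rot j))

  rank-cong : ∀ {i j} → rot i ≡ rot j → rank i ≡ rank j
  rank-cong eq = Σ<-cong n (λ k → cong (λ u → 𝟙 (rot k <lex? u)) eq)

  rank-mono : ∀ {i j} → rot i <lex rot j → rank i < rank j
  rank-mono {i} {j} p = Σ<-mono-< n (λ k → 𝟙-mono (rot k <lex? rot i) (rot k <lex? rot j) (λ q → <lex-trans q p))
    -- Strictness comes from the index `i % n`, which represents `rot i` itself: it is counted for
    -- `rot j` but not for `rot i`.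
    (ℕ.m%n<n i n)
    (subst₂ _<_ (sym (𝟙-no (_ <lex? _) (subst (λ u → ¬ u <lex rot i) (sym (rot-% i)) <lex-irrefl)))
      (sym (𝟙-yes (_ <lex? _) (subst (_<lex rot j) (sym (rot-% i)) p))) (s≤s z≤n))

  rank-injective : ∀ {i j} → rank i ≡ rank j → rot i ≡ rot j
  rank-injective {i} {j} eq with <lex-connected (rot i) (rot j)
  ... | inj₁ p        = p
  ... | inj₂ (inj₁ p) = ⊥-elim (ℕ.<-irrefl eq (rank-mono p))
  ... | inj₂ (inj₂ p) = ⊥-elim (ℕ.<-irrefl (sym eq) (rank-mono p))

  rank<n : ∀ j → rank j < n
  rank<n j = subst (rank j <_) (Σ<-const n) (Σ<-mono-< n
    (λ i → 𝟙-mono (rot i <lex? rot j) (yes tt) _) (ℕ.m%n<n j n)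
    (subst (_< 1) (sym (𝟙-no (_ <lex? _) (subst (λ u → ¬ u <lex rot j) (sym (rot-% j)) <lex-irrefl))) (s≤s z≤n)))

  below at above : Fin r → ℕ → ℕ
  below c i = 𝟙 (W i <? c)
  at    c i = 𝟙 (W i ≟ c)
  above c i = 𝟙 (c <? W i)

  -- The rotations starting with `c` occupy `Eq c` consecutive ranks from `Lo c` on. Once the order
  -- of the blocks is reversed, the block of `c` starts at `Hi c`.
  Lo Eq Hi : Fin r → ℕ
  Lo c = Σ< n (below c)
  Eq c = Σ< n (at c)
  Hi c = Σ< n (above c)

  Before : ℕ → ℕ → ℕ
  Before j i = 𝟙 (W i ≟ W j) * 𝟙 (rot i <lex? rot j)

  Offset : ℕ → ℕ
  Offset j = Σ< n (Before j)

  Lo+Eq+Hi≡n : ∀ c → Lo c + Eq c + Hi c ≡ n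
  Lo+Eq+Hi≡n c = trans (trans (cong (_+ Hi c) (sym (Σ<-+ n (below c) (at c)))) (sym (Σ<-+ n (λ i → below c i + at c i) (above c))))
    (trans (Σ<-cong n one) (Σ<-const n))
    where
    one : ∀ i → 𝟙 (W i <? c) + 𝟙 (W i ≟ c) + 𝟙 (c <? W i) ≡ 1
    one i with F.<-cmp (W i) c
    ... | tri< p q s rewrite 𝟙-yes (W i <? c) p | 𝟙-no (W i ≟ c) q | 𝟙-no (c <? W i) s = refl
    ... | tri≈ p q s rewrite 𝟙-no (W i <? c) p | 𝟙-yes (W i ≟ c) q | 𝟙-no (c <? W i) s = refl
    ... | tri> p q s rewrite 𝟙-no (W i <? c) p | 𝟙-no (W i ≟ c) q | 𝟙-yes (c <? W i) s = refl

  -- A rotation precedes `rot j` through a smaller first letter, or through an equal one and a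
  -- smaller rest; `Offset j` counts the second kind.
  rank≡Lo+Offset : ∀ j → rank j ≡ Lo (W j) + Offset j
  rank≡Lo+Offset j = trans (Σ<-cong n split) (Σ<-+ n (below (W j)) (Before j))
    where
    split : ∀ i → 𝟙 (rot i <lex? rot j) ≡ 𝟙 (W i <? W j) + Before j i
    split i with F.<-cmp (W i) (W j)
    ... | tri< p q s rewrite 𝟙-yes (W i <? W j) p | 𝟙-no (W i ≟ W j) q =
      𝟙-yes (rot i <lex? rot j) (here p)
    ... | tri≈ p q s rewrite 𝟙-no (W i <? W j) p | 𝟙-yes (W i ≟ W j) q = sym (ℕ.+-identityʳ _)
    ... | tri> p q s rewrite 𝟙-no (W i <? W j) p | 𝟙-no (W i ≟ W j) q =
      𝟙-no (rot i <lex? rot j) (λ lt → ℕ.<⇒≱ s (rot-≤-head {i} {j} lt))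

  Offset<Eq : ∀ j → Offset j < Eq (W j)
  Offset<Eq j = Σ<-mono-< n le (ℕ.m%n<n j n) (subst₂ _<_
      (sym (trans (cong (𝟙 (W k ≟ W j) *_) (𝟙-no (rot k <lex? rot j) (subst (λ u → ¬ u <lex rot j) (sym (rot-% j)) <lex-irrefl)))
        (ℕ.*-zeroʳ (𝟙 (W k ≟ W j)))))
      (sym (𝟙-yes (W k ≟ W j) (rot≡⇒W≡ {k} {j} (rot-% j)))) (s≤s z≤n))
    where
    k = j % n
    le : ∀ i → Before j i ≤ 𝟙 (W i ≟ W j)
    le i = subst (Before j i ≤_) (ℕ.*-identityʳ (𝟙 (W i ≟ W j)))
      (ℕ.*-monoʳ-≤ (𝟙 (W i ≟ W j)) (𝟙-mono (rot i <lex? rot j) (yes tt) (λ _ → tt)))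

  -- Clustering turns the rotation j ↦ suc j into a symmetric discrete interval exchange on ranks.
  rank-suc≡Hi+Offset : (∀ {i j} → rot (suc i) <lex rot (suc j) → W j F.≤ W i) →
    ∀ j → rank (suc j) ≡ Hi (W j) + Offset j
  rank-suc≡Hi+Offset antitone j = trans
    (sym (Σ<-shift n (λ i → 𝟙 (rot i <lex? rot (suc j))) (cong (λ u → 𝟙 (u <lex? rot (suc j))) (rot-periodic 0))))
    (trans (Σ<-cong n split) (Σ<-+ n (above (W j)) (Before j)))
    where
    split : ∀ i → 𝟙 (rot (suc i) <lex? rot (suc j)) ≡ 𝟙 (W j <? W i) + Before j i
    split i with F.<-cmp (W i) (W j)
    ... | tri< p q s rewrite 𝟙-no (W j <? W i) s | 𝟙-no (W i ≟ W j) q =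
      𝟙-no (rot (suc i) <lex? rot (suc j)) (λ lt → ℕ.<⇒≱ p (antitone lt))
    ... | tri≈ p q s rewrite 𝟙-no (W j <? W i) s | 𝟙-yes (W i ≟ W j) q =
      trans (ℕ.≤-antisym (𝟙-mono (rot (suc i) <lex? rot (suc j)) (rot i <lex? rot j) (rot-<-pred {i} {j} q))
        (𝟙-mono (rot i <lex? rot j) (rot (suc i) <lex? rot (suc j)) (rot-<-suc {i} {j} q))) (sym (ℕ.+-identityʳ _))
    ... | tri> p q s rewrite 𝟙-yes (W j <? W i) s | 𝟙-no (W i ≟ W j) q =
      𝟙-yes (rot (suc i) <lex? rot (suc j)) lt
      where
      lt : rot (suc i) <lex rot (suc j)
      lt with <lex-connected (rot (suc i)) (rot (suc j))
      ... | inj₂ (inj₁ lt) = lt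
      ... | inj₂ (inj₂ gt) = ⊥-elim (ℕ.<⇒≱ s (antitone gt))
      ... | inj₁ eq = ⊥-elim (q (L.∷ʳ-injectiveʳ _ _ (trans (sym (rot-suc i)) (trans eq (rot-suc j)))))

  Lo-blocks : ∀ {c c′} → c F.< c′ → Lo c + Eq c ≤ Lo c′
  Lo-blocks {c} {c′} c<c′ = subst (_≤ Lo c′) (Σ<-+ n (below c) (at c)) (Σ<-mono-≤ n le)
    where
    le : ∀ i → 𝟙 (W i <? c) + 𝟙 (W i ≟ c) ≤ 𝟙 (W i <? c′)
    le i with F.<-cmp (W i) c
    ... | tri< p q s rewrite 𝟙-yes (W i <? c) p | 𝟙-no (W i ≟ c) q | 𝟙-yes (W i <? c′) (F.<-trans p c<c′) = ℕ.≤-refl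
    ... | tri≈ p q s rewrite 𝟙-no (W i <? c) p | 𝟙-yes (W i ≟ c) q | 𝟙-yes (W i <? c′) (subst (F._< c′) (sym q) c<c′) = ℕ.≤-refl
    ... | tri> p q s rewrite 𝟙-no (W i <? c) p | 𝟙-no (W i ≟ c) q = z≤n

  Hi-blocks : ∀ {c c′} → c F.< c′ → Hi c′ + Eq c′ ≤ Hi c
  Hi-blocks {c} {c′} c<c′ = subst (_≤ Hi c) (Σ<-+ n (above c′) (at c′)) (Σ<-mono-≤ n le)
    where
    le : ∀ i → 𝟙 (c′ <? W i) + 𝟙 (W i ≟ c′) ≤ 𝟙 (c <? W i)
    le i with F.<-cmp (W i) c′
    ... | tri> p q s rewrite 𝟙-yes (c′ <? W i) s | 𝟙-no (W i ≟ c′) q | 𝟙-yes (c <? W i) (F.<-trans c<c′ s) = ℕ.≤-refl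
    ... | tri≈ p q s rewrite 𝟙-no (c′ <? W i) s | 𝟙-yes (W i ≟ c′) q | 𝟙-yes (c <? W i) (subst (c F.<_) (sym q) c<c′) = ℕ.≤-refl
    ... | tri< p q s rewrite 𝟙-no (c′ <? W i) s | 𝟙-no (W i ≟ c′) q = z≤n

  module Aperiodic (prim : Primitive (rot 0)) where

    -- A coincidence at `0 < d < n` makes the two nonempty pieces of the cut at `d` commute, so the
    -- word is a proper power.
    rot0-injective : ∀ {d} → d < n → rot 0 ≡ rot d → d ≡ 0
    rot0-injective {zero}  _   _  = refl
    rot0-injective {suc d} d<n eq = ⊥-elim (primitive⇒¬commuting (win 0 (suc d)) (win (suc d) (n ∸ suc d))
      (subst Primitive (rot0-cut (ℕ.<⇒≤ d<n)) prim) (λ ()) nonempty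
      (trans (sym (rot0-cut (ℕ.<⇒≤ d<n))) (trans eq (rot-cut (ℕ.<⇒≤ d<n)))))
      where
      nonempty : win (suc d) (n ∸ suc d) ≢ []
      nonempty p = ℕ.m>n⇒m∸n≢0 d<n (trans (sym (length-win (suc d) _)) (cong length p))

    -- Advancing by `s * m` further positions turns `s` into the multiple `s * n` of the period,
    -- which reduces the claim to `rot 0`.
    rot-aperiodic : ∀ s {d} → d < n → rot s ≡ rot (s + d) → d ≡ 0
    rot-aperiodic s {d} d<n eq = rot0-injective d<n (begin
      rot 0                ≡⟨ sym (rot-+* 0 s) ⟩
      rot (s * n)          ≡⟨ cong rot (sn s m) ⟩
      rot (s * m + s)      ≡⟨ rot≡-+ {s} {s + d} eq (s * m) ⟩
      rot (s * m + (s + d)) ≡⟨ cong rot (sdn s m d) ⟩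
      rot (d + s * n)      ≡⟨ rot-+* d s ⟩
      rot d                ∎)
      where
      open ≡-Reasoning
      sn : ∀ s m → s * suc m ≡ s * m + s
      sn = solve-∀
      sdn : ∀ s m d → s * m + (s + d) ≡ d + s * suc m
      sdn = solve-∀

    rot-injective-≤ : ∀ h {i j} → i ≤ j → j < n → rot (h + i) ≡ rot (h + j) → i ≡ j
    rot-injective-≤ h {i} {j} i≤j j<n eq = sym (trans (sym (ℕ.m+[n∸m]≡n i≤j)) (trans (cong (i +_)
      (rot-aperiodic (h + i) (ℕ.≤-<-trans (ℕ.m∸n≤m j i) j<n) (trans eq (cong rot
        (trans (cong (h +_) (sym (ℕ.m+[n∸m]≡n i≤j))) (sym (ℕ.+-assoc h i (j ∸ i)))))))) (ℕ.+-identityʳ i)))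

    rot-injective : ∀ h {i j} → i < n → j < n → rot (h + i) ≡ rot (h + j) → i ≡ j
    rot-injective h {i} {j} i<n j<n eq with ℕ.≤-total i j
    ... | inj₁ i≤j = rot-injective-≤ h i≤j j<n eq
    ... | inj₂ j≤i = sym (rot-injective-≤ h j≤i i<n (sym eq))

    -- If `x` were missed, `x` and the ranks of the `n` rotations would be `suc n` distinct numbers
    -- below `n`.
    rank-surjective : ∀ {x} → x < n → ∃ λ i → i < n × rank i ≡ x
    rank-surjective {x} x<n with F.any? (λ i → rank (toℕ i) ℕ.≟ x)
    ... | yes (i , p) = toℕ i , F.toℕ<n i , p
    ... | no  missed  = ⊥-elim (collision (F.pigeonhole (ℕ.n<1+n n) f))
      where
      f : Fin (suc n) → Fin n
      f F.zero    = fromℕ< x<n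
      f (F.suc i) = fromℕ< (rank<n (toℕ i))
      collision : ¬ (∃₂ λ i j → i F.< j × f i ≡ f j)
      collision (F.zero  , F.suc j , _ , eq) = missed (j , sym (F.fromℕ<-injective _ _ x<n (rank<n (toℕ j)) eq))
      collision (F.suc i , F.suc j , s≤s i<j , eq) = ℕ.<-irrefl
        (rot-injective 0 (F.toℕ<n i) (F.toℕ<n j) (rank-injective
          (F.fromℕ<-injective _ _ (rank<n (toℕ i)) (rank<n (toℕ j)) eq))) i<j

-- Clustering gives palindromes

xor-cancelling : ∀ a b → (a xor b) xor b ≡ a
xor-cancelling a b = trans (B.xor-assoc a b b) (trans (cong (a xor_) (B.xor-same b)) (B.xor-identityʳ a))

xor-cancelʳ : ∀ a b c → a xor c ≡ b xor c → a ≡ b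
xor-cancelʳ a b c eq = trans (sym (xor-cancelling a c)) (trans (cong (_xor c) eq) (xor-cancelling b c))

letters⊆assemble : ∀ {r} (a : Fin r) rest {c} → c ∈ letters a rest → c ∈ assemble a rest
letters⊆assemble a rest             (here p)   = here p
letters⊆assemble a ((π , b) ∷ rest) (there c∈) = there (subst (_ ∈_) (sym (L.++-assoc π [ b ] _))
  (Any.++⁺ʳ π (letters⊆assemble b rest c∈)))

-- The points are `0` to `k - 1`, mirrored by `suc (u + v) ≡ k`. The jump `g u` sits between `u` and
-- `suc u`, so jumps are mirrored by `suc (suc (u + v)) ≡ k`.
module Mirror (s g : ℕ → Bool) (jump : ∀ u → s (suc u) ≡ s u xor g u) (k : ℕ)
  (symmetric : ∀ u v → suc (suc (u + v)) ≡ k → g u ≡ g v)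
  (centre : ∀ u → suc (suc (u + u)) ≡ k → g u ≡ false) where

  mirror-≤ : ∀ d u → suc (u + (u + d)) ≡ k → s u ≡ s (u + d)
  mirror-≤ zero u _ = cong s (sym (ℕ.+-identityʳ u))
  mirror-≤ (suc zero) u eq = sym (trans (cong s (ℕ.+-comm u 1))
    (trans (jump u) (trans (cong (s u xor_) (centre u (trans (shape u) eq))) (B.xor-identityʳ (s u)))))
    where
    shape : ∀ u → suc (suc (u + u)) ≡ suc (u + (u + 1))
    shape = solve-∀
  -- The two outermost jumps are equal and cancel; the induction moves both ends inward by one.
  mirror-≤ (suc (suc d)) u eq = xor-cancelʳ _ _ (g u) (begin
    s u xor g u                        ≡⟨ jump u ⟨
    s (suc u)                          ≡⟨ mirror-≤ d (suc u) (trans (inner u d) eq) ⟩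
    s v                                ≡⟨ xor-cancelling (s v) (g v) ⟨
    (s v xor g v) xor g v              ≡⟨ cong₂ _xor_ (jump v) (symmetric u v (trans (outer u d) eq)) ⟨
    s (suc v) xor g u                  ≡⟨ cong (λ x → s x xor g u) (last u d) ⟩
    s (u + suc (suc d)) xor g u        ∎)
    where
    open ≡-Reasoning
    v = suc u + d
    inner : ∀ u d → suc (suc u + (suc u + d)) ≡ suc (u + (u + suc (suc d)))
    inner = solve-∀
    outer : ∀ u d → suc (suc (u + (suc u + d))) ≡ suc (u + (u + suc (suc d)))
    outer = solve-∀
    last : ∀ u d → suc (suc u + d) ≡ u + suc (suc d)
    last = solve-∀

  -- The jumps of s are placed symmetrically and none sits at the centre, so between
  -- mirror-symmetric points they cancel in pairs.
  mirror : ∀ u v → suc (u + v) ≡ k → s u ≡ s v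
  mirror u v eq with ℕ.≤-total u v
  ... | inj₁ u≤v = trans (mirror-≤ (v ∸ u) u (trans (cong (λ v → suc (u + v)) (ℕ.m+[n∸m]≡n u≤v)) eq))
    (cong s (ℕ.m+[n∸m]≡n u≤v))
  ... | inj₂ v≤u = sym (trans (mirror-≤ (u ∸ v) v (trans (cong (λ u → suc (v + u)) (ℕ.m+[n∸m]≡n v≤u))
    (trans (cong suc (ℕ.+-comm v u)) eq))) (cong s (ℕ.m+[n∸m]≡n v≤u)))

-- Boundaries `1` to `t` are those separating rank `0` from rank `t`; `true` stands for an odd
-- number of them satisfying `P`.
parity : {P : ℕ → Set} → (∀ t → Dec (P t)) → ℕ → Bool
parity P? zero    = false
parity P? (suc t) = parity P? t xor does (P? (suc t))

-- The symmetric interval exchange on ranks and its boundaries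

module SymmetricExchange {r : ℕ} (m : ℕ) (W : ℕ → Fin r) (periodic : ∀ i → W (i + suc m) ≡ W i) where

  open Cyclic m W periodic

  module _ (prim : Primitive (rot 0))
    (antitone : ∀ {i j} → rot (suc i) <lex rot (suc j) → W j F.≤ W i)
    (rank0≡0 : rank 0 ≡ 0) where

    open Aperiodic prim

    _∈Lo_ _∈Hi_ : ℕ → Fin r → Set
    x ∈Lo c = Lo c ≤ x × x < Lo c + Eq c
    x ∈Hi c = Hi c ≤ x × x < Hi c + Eq c

    ∈Lo-unique : ∀ {x c c′} → x ∈Lo c → x ∈Lo c′ → c ≡ c′
    ∈Lo-unique {x} {c} {c′} (l , u) (l′ , u′) with F.<-cmp c c′
    ... | tri≈ _ eq _ = eq
    ... | tri< lt _ _ = ⊥-elim (ℕ.<⇒≱ u (ℕ.≤-trans (Lo-blocks lt) l′))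
    ... | tri> _ _ gt = ⊥-elim (ℕ.<⇒≱ u′ (ℕ.≤-trans (Lo-blocks gt) l))

    ∈Hi-unique : ∀ {x c c′} → x ∈Hi c → x ∈Hi c′ → c ≡ c′
    ∈Hi-unique {x} {c} {c′} (l , u) (l′ , u′) with F.<-cmp c c′
    ... | tri≈ _ eq _ = eq
    ... | tri< lt _ _ = ⊥-elim (ℕ.<⇒≱ u′ (ℕ.≤-trans (Hi-blocks lt) l))
    ... | tri> _ _ gt = ⊥-elim (ℕ.<⇒≱ u (ℕ.≤-trans (Hi-blocks gt) l′))

    rank-suc≡ : ∀ j → rank (suc j) ≡ Hi (W j) + Offset j
    rank-suc≡ = rank-suc≡Hi+Offset antitone

    rank∈Lo : ∀ j → rank j ∈Lo W j
    rank∈Lo j rewrite rank≡Lo+Offset j = ℕ.m≤m+n _ _ , ℕ.+-monoʳ-< (Lo (W j)) (Offset<Eq j)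

    rank-suc∈Hi : ∀ j → rank (suc j) ∈Hi W j
    rank-suc∈Hi j rewrite rank-suc≡ j = ℕ.m≤m+n _ _ , ℕ.+-monoʳ-< (Hi (W j)) (Offset<Eq j)

    -- The witness is the offset to which the flip of the block sends `Offset j`.
    complement : ∀ j → ∃ λ v → suc (Offset j + v) ≡ Eq (W j)
    complement j = ℕ.m≤n⇒∃[o]m+o≡n (Offset<Eq j)

    -- A set Γ of boundaries t (between the ranks t - 1 and t) that is invariant under the flip of all
    -- ranks and under the flip of each block, and has no fixed boundary, is empty: the parity of the
    -- number of its elements to the left of a rank is invariant under both flips, hence constant
    -- along the orbit, which consists of all ranks.
    module InvariantBoundaries (Γ : ℕ → Set) (Γ? : ∀ t → Dec (Γ t))
      (R-closed : ∀ {t t′} → t + t′ ≡ n → Γ t → Γ t′)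
      (R-free   : ∀ {t} → t + t ≡ n → ¬ Γ t)
      (ι-closed : ∀ {c t t′} → Lo c < t → Lo c < t′ → t + t′ ≡ Lo c + Lo c + Eq c → Γ t → Γ t′)
      (ι-free   : ∀ {c t} → Lo c < t → t + t ≡ Lo c + Lo c + Eq c → ¬ Γ t) where

      side : ℕ → Bool
      side = parity Γ?

      side-R : ∀ x y → suc (x + y) ≡ n → side x ≡ side y
      side-R = mirror
        where
        shape : ∀ u v → suc u + suc v ≡ suc (suc (u + v))
        shape = solve-∀
        open Mirror side (λ t → does (Γ? (suc t))) (λ _ → refl) n
          (λ u v eq → does-⇔ (mk⇔ (R-closed (trans (shape u v) eq))
            (R-closed (trans (shape v u) (trans (cong (suc ∘ suc) (ℕ.+-comm v u)) eq)))) (Γ? (suc u)) (Γ? (suc v)))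
          (λ u eq → dec-false (Γ? (suc u)) (R-free (trans (shape u u) eq)))

      side-ι : ∀ c u v → suc (u + v) ≡ Eq c → side (Lo c + u) ≡ side (Lo c + v)
      side-ι c = mirror
        where
        l = Lo c
        shape : ∀ l u v → suc (l + u) + suc (l + v) ≡ l + l + suc (suc (u + v))
        shape = solve-∀
        closed : ∀ u v → suc (suc (u + v)) ≡ Eq c → Γ (suc (l + u)) → Γ (suc (l + v))
        closed u v eq = ι-closed {c} (s≤s (ℕ.m≤m+n l u)) (s≤s (ℕ.m≤m+n l v))
          (trans (shape l u v) (cong (l + l +_) eq))
        open Mirror (λ t → side (l + t)) (λ t → does (Γ? (suc (l + t)))) (λ t → cong side (ℕ.+-suc l t)) (Eq c)
          (λ u v eq → does-⇔ (mk⇔ (closed u v eq)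
            (closed v u (trans (cong (suc ∘ suc) (ℕ.+-comm v u)) eq))) (Γ? (suc (l + u))) (Γ? (suc (l + v))))
          (λ u eq → dec-false (Γ? (suc (l + u))) (ι-free {c} (s≤s (ℕ.m≤m+n l u))
            (trans (shape l u u) (cong (l + l +_) eq))))

      -- The flip of its block sends `rank j` to `Lo c + v`, and the flip of all ranks sends this to
      -- `rank (suc j)`; `side` is invariant under both.
      side-suc : ∀ j → side (rank (suc j)) ≡ side (rank j)
      side-suc j with complement j
      ... | v , eq = sym (begin
        side (rank j)            ≡⟨ cong side (rank≡Lo+Offset j) ⟩
        side (Lo c + Offset j)   ≡⟨ side-ι c (Offset j) v eq ⟩
        side (Lo c + v)          ≡⟨ side-R (Lo c + v) (Hi c + Offset j) (trans (shape (Lo c) v (Hi c) (Offset j))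
                                      (trans (cong (λ e → Lo c + e + Hi c) eq) (Lo+Eq+Hi≡n c))) ⟩
        side (Hi c + Offset j)   ≡⟨ cong side (rank-suc≡ j) ⟨
        side (rank (suc j))      ∎)
        where
        open ≡-Reasoning
        c = W j
        shape : ∀ l v h d → suc (l + v + (h + d)) ≡ l + suc (d + v) + h
        shape = solve-∀

      side-const : ∀ j → side (rank j) ≡ side (rank 0)
      side-const zero    = refl
      side-const (suc j) = trans (side-suc j) (side-const j)

      -- The ranks `t - 1` and `t` both occur on the orbit, where `side` is constant; an element `t`
      -- of `Γ` would make it change between them.
      empty : ∀ {t} → 0 < t → t < n → ¬ Γ t
      empty {suc t} _ t<n Γt with rank-surjective t<n | rank-surjective (ℕ.<-trans (ℕ.n<1+n t) t<n)
      ... | i , _ , p | j , _ , q = contra (side t) (begin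
        side t xor true                 ≡⟨ cong (side t xor_) (dec-true (Γ? (suc t)) Γt) ⟨
        side (suc t)                    ≡⟨ cong side p ⟨
        side (rank i)                   ≡⟨ trans (side-const i) (sym (side-const j)) ⟩
        side (rank j)                   ≡⟨ cong side q ⟩
        side t                          ∎)
        where
        open ≡-Reasoning
        contra : ∀ b → b xor true ≢ b
        contra false ()
        contra true  ()

    -- The rotation is the least with its first letter, so the boundary on its left is the left end
    -- of a block.
    Start : ℕ → Set
    Start i = rank i ≡ Lo (W i)

    Start? : ∀ i → Dec (Start i)
    Start? i = rank i ℕ.≟ Lo (W i)

    rank-positive : ∀ {k i} → rank k + rank i ≡ n → 0 < rank k
    rank-positive {k} {i} eq with rank k
    ... | zero  = ⊥-elim (ℕ.<-irrefl eq (rank<n i))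
    ... | suc _ = s≤s z≤n

    -- For boundaries x = rank (suc k) and n - x = rank i: reflecting n - x inside its block gives rank k.
    reflect : ∀ k i → rank (suc k) + rank i ≡ n → ¬ Start i →
      W k ≡ W i × rank k + rank i ≡ Lo (W i) + Lo (W i) + Eq (W i) × rank k + rank (suc i) ≡ n × Lo (W i) < rank k
    reflect k i sum ¬start with Offset i in offset | complement i
    ... | zero  | _      = ⊥-elim (¬start (trans (rank≡Lo+Offset i)
                             (trans (cong (Lo (W i) +_) offset) (ℕ.+-identityʳ _))))
    ... | suc d | o , eq = Wk≡c , sum₁ , sum₂ , lower
      where
      c = W i
      rank-i : rank i ≡ Lo c + suc d
      rank-i = trans (rank≡Lo+Offset i) (cong (Lo c +_) offset)
      rank-suc-k : rank (suc k) ≡ Hi c + suc o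
      rank-suc-k = ℕ.+-cancelʳ-≡ (Lo c + suc d) _ _ (begin
        rank (suc k) + (Lo c + suc d)      ≡⟨ cong (rank (suc k) +_) rank-i ⟨
        rank (suc k) + rank i              ≡⟨ sum ⟩
        n                                  ≡⟨ Lo+Eq+Hi≡n c ⟨
        Lo c + Eq c + Hi c                 ≡⟨ cong (λ e → Lo c + e + Hi c) eq ⟨
        Lo c + suc (suc d + o) + Hi c      ≡⟨ shape (Lo c) d o (Hi c) ⟩
        Hi c + suc o + (Lo c + suc d)      ∎)
        where
        open ≡-Reasoning
        shape : ∀ l d o h → l + suc (suc d + o) + h ≡ h + suc o + (l + suc d)
        shape = solve-∀
      -- The letter before an index is determined by the exchanged block that contains its rank.
      Wk≡c : W k ≡ c
      Wk≡c = ∈Hi-unique (rank-suc∈Hi k) (subst (_∈Hi c) (sym rank-suc-k)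
        (ℕ.m≤m+n (Hi c) (suc o) , ℕ.+-monoʳ-< (Hi c) (subst (suc o <_) eq (s≤s (s≤s (ℕ.m≤n+m o d))))))
      offset-k : Offset k ≡ suc o
      offset-k = ℕ.+-cancelˡ-≡ (Hi c) _ _ (trans (cong (λ b → Hi b + Offset k) (sym Wk≡c))
        (trans (sym (rank-suc≡ k)) rank-suc-k))
      rank-k : rank k ≡ Lo c + suc o
      rank-k = trans (rank≡Lo+Offset k) (cong₂ (λ b e → Lo b + e) Wk≡c offset-k)
      sum₁ : rank k + rank i ≡ Lo c + Lo c + Eq c
      sum₁ = trans (cong₂ _+_ rank-k rank-i) (trans (shape (Lo c) o d) (cong (Lo c + Lo c +_) eq))
        where
        shape : ∀ l o d → l + suc o + (l + suc d) ≡ l + l + suc (suc d + o)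
        shape = solve-∀
      sum₂ : rank k + rank (suc i) ≡ n
      sum₂ = trans (cong₂ _+_ rank-k (trans (rank-suc≡ i) (cong (Hi c +_) offset)))
        (trans (shape (Lo c) o (Hi c) d) (trans (cong (λ e → Lo c + e + Hi c) eq) (Lo+Eq+Hi≡n c)))
        where
        shape : ∀ l o h d → l + suc o + (h + suc d) ≡ l + suc (suc d + o) + h
        shape = solve-∀
      lower : Lo c < rank k
      lower = subst (Lo c <_) (sym rank-k) (ℕ.m<m+n (Lo c) (s≤s z≤n))

    -- Each reflection moves the first index back and the second forward. The first never reaches
    -- `0`: its rank would be `0` and its partner `n`, which is not a rank. So a start is met within
    -- `k` steps.
    firstStart : ∀ k i → rank k + rank i ≡ n →
      ∃ λ J → J ≤ k × Start (i + J) × (∀ {j} → j < J → ¬ Start (i + j))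
    firstStart zero    i eq = ⊥-elim (ℕ.<-irrefl (trans (cong (_+ rank i) (sym rank0≡0)) eq) (rank<n i))
    firstStart (suc k) i eq with Start? i
    ... | yes start = 0 , z≤n , subst Start (sym (ℕ.+-identityʳ i)) start , λ ()
    ... | no ¬start with firstStart k (suc i) (proj₁ (proj₂ (proj₂ (reflect k i eq ¬start))))
    ...   | J , J≤k , start , earlier = suc J , s≤s J≤k , subst Start (sym (ℕ.+-suc i J)) start , earlier′
      where
      earlier′ : ∀ {j} → j < suc J → ¬ Start (i + j)
      earlier′ {zero}  _         = subst (¬_ ∘ Start) (sym (ℕ.+-identityʳ i)) ¬start
      earlier′ {suc j} (s≤s j<J) = subst (¬_ ∘ Start) (sym (ℕ.+-suc i j)) (earlier j<J)

    -- The flips exchange the boundaries rank q, rank (q - 1), … with rank i, rank (i + 1), ….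
    module Gap (q i : ℕ) (q<n : q < n) (i<n : i < n) (start-q : Start q) (sum₀ : rank q + rank i ≡ n) where

      J : ℕ
      J = proj₁ (firstStart q i sum₀)

      J≤q : J ≤ q
      J≤q = proj₁ (proj₂ (firstStart q i sum₀))

      start-end : Start (i + J)
      start-end = proj₁ (proj₂ (proj₂ (firstStart q i sum₀)))

      ¬start : ∀ {j} → j < J → ¬ Start (i + j)
      ¬start = proj₂ (proj₂ (proj₂ (firstStart q i sum₀)))

      y z : ℕ → ℕ
      y j = rank (q ∸ j)
      z j = rank (i + j)

      q∸ : ∀ {j} → j < J → q ∸ j ≡ suc (q ∸ suc j)
      q∸ j<J = ℕ.+-∸-assoc 1 (ℕ.<-≤-trans j<J J≤q)

      y+z≡n : ∀ j → j ≤ J → y j + z j ≡ n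
      y+z≡n zero    _   = trans (cong (λ i → rank q + rank i) (ℕ.+-identityʳ i)) sum₀
      y+z≡n (suc j) j<J = trans (cong (λ i → y (suc j) + rank i) (ℕ.+-suc i j))
        (proj₁ (proj₂ (proj₂ (reflect (q ∸ suc j) (i + j)
          (trans (cong (λ k → rank k + z j) (sym (q∸ j<J))) (y+z≡n j (ℕ.<⇒≤ j<J))) (¬start j<J)))))

      reflect-j : ∀ {j} → j < J → W (q ∸ suc j) ≡ W (i + j)
        × y (suc j) + z j ≡ Lo (W (i + j)) + Lo (W (i + j)) + Eq (W (i + j))
        × Lo (W (i + j)) < y (suc j)
      reflect-j {j} j<J with reflect (q ∸ suc j) (i + j)
          (trans (cong (λ k → rank k + z j) (sym (q∸ j<J))) (y+z≡n j (ℕ.<⇒≤ j<J))) (¬start j<J)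
      ... | same , sum , _ , lower = same , sum , lower

      ¬start-y : ∀ {j} → j < J → ¬ Start (q ∸ suc j)
      ¬start-y j<J start with reflect-j j<J
      ... | same , _ , lower = ℕ.<-irrefl (trans (cong Lo (sym same)) (sym start)) lower

      i+j<n : ∀ j → j ≤ J → i + j < n
      i+j<n zero    _   = subst (_< n) (sym (ℕ.+-identityʳ i)) i<n
      i+j<n (suc j) j<J with ℕ.m≤n⇒m<n∨m≡n (subst (_≤ n) (sym (ℕ.+-suc i j)) (i+j<n j (ℕ.<⇒≤ j<J)))
      ... | inj₁ lt = lt
      -- At index `n` the forward rank would be that of `rot 0`, namely `0`, forcing the backward
      -- rank to be `n`.
      ... | inj₂ eq = ⊥-elim (ℕ.<-irrefl (trans (sym (ℕ.+-identityʳ _))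
        (trans (cong (y (suc j) +_) (sym (trans (cong rank eq) (trans (rank-cong (rot-periodic 0)) rank0≡0))))
          (y+z≡n (suc j) j<J))) (rank<n (q ∸ suc j)))

      -- Here `q` is `i + (b + a)`. If `b + a < J`, the forward chain would meet the start `q`
      -- before its end; if `b + a > J`, the backward chain would pass through the start `i + J`,
      -- though only its first index `q` can be a start before the end.
      coincide : ∀ {a b} → a ≤ J → b ≤ J → q ∸ a ≡ i + b → q ≡ i + J
      coincide {a} {b} a≤J b≤J eq with ℕ.<-cmp (b + a) J
      ... | tri< lt _ _ = ⊥-elim (¬start lt (subst Start q≡ start-q))
        where
        q≡ : q ≡ i + (b + a)
        q≡ = trans (sym (ℕ.m∸n+n≡m (ℕ.≤-trans a≤J J≤q))) (trans (cong (_+ a) eq) (ℕ.+-assoc i b a))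
      ... | tri≈ _ p _ = trans (sym (ℕ.m∸n+n≡m (ℕ.≤-trans a≤J J≤q)))
        (trans (cong (_+ a) eq) (trans (ℕ.+-assoc i b a) (cong (i +_) p)))
      ... | tri> _ _ gt with ℕ.m≤n⇒∃[o]m+o≡n gt
      ...   | e , p = ⊥-elim (¬start-y e<J (subst Start (sym q∸e≡) start-end))
        where
        e<J : e < J
        e<J = ℕ.+-cancelˡ-< J _ _ (subst (_≤ J + J) (sym p) (ℕ.+-mono-≤ b≤J a≤J))
        q≡ : q ≡ i + J + suc e
        q≡ = trans (sym (ℕ.m∸n+n≡m (ℕ.≤-trans a≤J J≤q))) (trans (cong (_+ a) eq)
          (trans (ℕ.+-assoc i b a) (trans (cong (i +_) (trans (sym p) (sym (ℕ.+-suc J e)))) (sym (ℕ.+-assoc i J (suc e))))))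
        q∸e≡ : q ∸ suc e ≡ i + J
        q∸e≡ = trans (cong (_∸ suc e) q≡) (ℕ.m+n∸n≡m (i + J) (suc e))

      rank-coincide : ∀ {a b} → a ≤ J → b ≤ J → y a ≡ z b → q ≡ i + J
      rank-coincide {a} {b} a≤J b≤J eq = coincide a≤J b≤J
        (rot-injective 0 (ℕ.≤-<-trans (ℕ.m∸n≤m q a) q<n) (i+j<n b b≤J) (rank-injective eq))

      Γ : ℕ → Set
      Γ t = ∃ λ j → j < suc J × (t ≡ y j ⊎ t ≡ z j)

      Γ? : ∀ t → Dec (Γ t)
      Γ? t = ℕ.anyUpTo? (λ j → (t ℕ.≟ y j) ⊎-dec (t ℕ.≟ z j)) (suc J)

      R-closed : ∀ {t t′} → t + t′ ≡ n → Γ t → Γ t′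
      R-closed {t} {t′} eq (j , s≤s j≤J , inj₁ refl) = j , s≤s j≤J ,
        inj₂ (ℕ.+-cancelˡ-≡ (y j) _ _ (trans eq (sym (y+z≡n j j≤J))))
      R-closed {t} {t′} eq (j , s≤s j≤J , inj₂ refl) = j , s≤s j≤J ,
        inj₁ (ℕ.+-cancelʳ-≡ (z j) _ _ (trans (ℕ.+-comm t′ (z j)) (trans eq (sym (y+z≡n j j≤J)))))

      inBlock : ∀ {c t t′} → Lo c < t → Lo c < t′ → t + t′ ≡ Lo c + Lo c + Eq c → t ∈Lo c
      inBlock {c} {t} {t′} lo lo′ eq = ℕ.<⇒≤ lo , ℕ.+-cancelʳ-< t′ t (Lo c + Eq c)
        (subst (_< Lo c + Eq c + t′) (sym (trans eq (shape (Lo c) (Eq c)))) (ℕ.+-monoʳ-< (Lo c + Eq c) lo′))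
        where
        shape : ∀ l e → l + l + e ≡ l + e + l
        shape = solve-∀

      -- The partner of an interior boundary under the flip of its block is its neighbour in the chain.
      ι-partner : ∀ {c t t′} → Lo c < t → Lo c < t′ → t + t′ ≡ Lo c + Lo c + Eq c → Γ t →
        ∃ λ j → j < J × ((t ≡ y (suc j) × t′ ≡ z j) ⊎ (t ≡ z j × t′ ≡ y (suc j)))
      -- `y 0` is the left end of a block, hence interior to none; `z J` is excluded below in the
      -- same way.
      ι-partner {c} {t} {t′} lo lo′ eq (zero , _ , inj₁ refl) = ⊥-elim (ℕ.<-irrefl
        (trans (cong Lo (∈Lo-unique (inBlock lo lo′ eq) (rank∈Lo q))) (sym start-q)) lo)
      ι-partner {c} {t} {t′} lo lo′ eq (suc j , s≤s j<J , inj₁ refl) with reflect-j j<J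
      ... | same , sum , _ with refl ← trans (∈Lo-unique (inBlock lo lo′ eq) (rank∈Lo (q ∸ suc j))) same =
        j , j<J , inj₁ (refl , ℕ.+-cancelˡ-≡ (y (suc j)) _ _ (trans eq (sym sum)))
      ι-partner {c} {t} {t′} lo lo′ eq (j , s≤s j≤J , inj₂ refl) with ℕ.m≤n⇒m<n∨m≡n j≤J
      ... | inj₂ refl = ⊥-elim (ℕ.<-irrefl
        (trans (cong Lo (∈Lo-unique (inBlock lo lo′ eq) (rank∈Lo (i + J)))) (sym start-end)) lo)
      ... | inj₁ j<J with refl ← ∈Lo-unique (inBlock lo lo′ eq) (rank∈Lo (i + j)) =
        j , j<J , inj₂ (refl , ℕ.+-cancelʳ-≡ (z j) _ _ (trans (ℕ.+-comm t′ (z j))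
          (trans eq (sym (proj₁ (proj₂ (reflect-j j<J)))))))

      -- If the chains stayed apart, their boundaries would form a nonempty set excluded by `empty`:
      -- a boundary fixed by either flip would be an equality between some `y` and some `z`.
      meets : q ≡ i + J
      meets with q ℕ.≟ i + J
      ... | yes eq = eq
      ... | no neq = ⊥-elim (empty (rank-positive sum₀) (rank<n q) (0 , s≤s z≤n , inj₁ refl))
        where
        R-free : ∀ {t} → t + t ≡ n → ¬ Γ t
        R-free {t} eq (j , s≤s j≤J , inj₁ refl) = neq (rank-coincide j≤J j≤J
          (ℕ.+-cancelˡ-≡ (y j) _ _ (trans eq (sym (y+z≡n j j≤J)))))
        R-free {t} eq (j , s≤s j≤J , inj₂ refl) = neq (rank-coincide j≤J j≤J
          (sym (ℕ.+-cancelʳ-≡ (z j) _ _ (trans eq (sym (y+z≡n j j≤J))))))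
        ι-closed : ∀ {c t t′} → Lo c < t → Lo c < t′ → t + t′ ≡ Lo c + Lo c + Eq c → Γ t → Γ t′
        ι-closed lo lo′ eq Γt with ι-partner lo lo′ eq Γt
        ... | j , j<J , inj₁ (_ , p) = j , s≤s (ℕ.<⇒≤ j<J) , inj₂ p
        ... | j , j<J , inj₂ (_ , p) = suc j , s≤s j<J , inj₁ p
        ι-free : ∀ {c t} → Lo c < t → t + t ≡ Lo c + Lo c + Eq c → ¬ Γ t
        ι-free lo eq Γt with ι-partner lo lo eq Γt
        ... | j , j<J , inj₁ (p , p′) = neq (rank-coincide j<J (ℕ.<⇒≤ j<J) (trans (sym p) p′))
        ... | j , j<J , inj₂ (p , p′) = neq (rank-coincide j<J (ℕ.<⇒≤ j<J) (trans (sym p′) p))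
        open InvariantBoundaries Γ Γ? R-closed R-free (λ {c} → ι-closed {c}) (λ {c} → ι-free {c})

      -- The reflections match the letter at `i + j` with that at `q ∸ suc j`; as the chains meet,
      -- the latter index is `i + j′`.
      palindromic : ∀ j j′ → suc (j + j′) ≡ J → W (i + j) ≡ W (i + j′)
      palindromic j j′ eq = trans (sym (proj₁ (reflect-j j<J))) (cong W (trans (cong (_∸ suc j) q≡)
          (ℕ.m+n∸n≡m (i + j′) (suc j))))
        where
        j<J : j < J
        j<J = subst (j <_) eq (s≤s (ℕ.m≤m+n j j′))
        q≡ : q ≡ i + j′ + suc j
        q≡ = trans meets (trans (cong (i +_) (trans (sym eq) (ℕ.+-comm (suc j) j′))) (sym (ℕ.+-assoc i j′ (suc j))))

    win-palindrome : ∀ i k → (∀ j j′ → suc (j + j′) ≡ k → W (i + j) ≡ W (i + j′)) → Palindrome (win i k)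
    win-palindrome i k sym-W = begin
      reverse (win i k)                     ≡⟨ cong reverse (win≡applyUpTo i k) ⟩
      reverse (applyUpTo (W ∘ (i +_)) k)    ≡⟨ L.reverse-applyUpTo (W ∘ (i +_)) k ⟩
      applyDownFrom (W ∘ (i +_)) k          ≡⟨ up≡down k sym-W ⟨
      applyUpTo (W ∘ (i +_)) k              ≡⟨ win≡applyUpTo i k ⟨
      win i k                               ∎
      where
      open ≡-Reasoning
      up≡down : ∀ {f g : ℕ → Fin r} k → (∀ j j′ → suc (j + j′) ≡ k → f j ≡ g j′) →
        applyUpTo f k ≡ applyDownFrom g k
      up≡down zero    eq = refl
      up≡down (suc k) eq = cong₂ _∷_ (eq 0 k refl) (up≡down k (λ j j′ p → eq (suc j) j′ (cong suc p)))

    -- The product of two palindromes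

    Mirrored : ℕ → ℕ → Set
    Mirrored j k = W j ≡ W k × suc (rank j + rank k) ≡ Lo (W j) + Lo (W j) + Eq (W j)

    -- Let `R` flip all ranks and `ι` each block; the exchange is `R ∘ ι`. If `ι` takes `rank j` to
    -- `rank (suc k)`, then `rank (suc j)` is `R` of the latter, hence `ι` of `rank k`.
    mirrored-suc : ∀ j k → Mirrored j (suc k) → Mirrored (suc j) k
    mirrored-suc j k (same , sum) with complement k
    ... | v , eq = Wj≡c , (begin
        suc (rank (suc j) + rank k)      ≡⟨ cong₂ (λ x y → suc (x + y)) rank-j (rank≡Lo+Offset k) ⟩
        suc (Lo c + v + (Lo c + Offset k)) ≡⟨ shape₂ (Lo c) v (Offset k) ⟩
        Lo c + Lo c + suc (Offset k + v)  ≡⟨ cong (Lo c + Lo c +_) eq ⟩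
        Lo c + Lo c + Eq c                ≡⟨ cong (λ b → Lo b + Lo b + Eq b) Wj≡c ⟨
        Lo (W (suc j)) + Lo (W (suc j)) + Eq (W (suc j)) ∎)
      where
      open ≡-Reasoning
      b = W j
      c = W k
      shape₁ : ∀ l d h x e → suc (h + d + x) + (l + e) ≡ suc (l + d + x) + (h + e)
      shape₁ = solve-∀
      shape₂ : ∀ l v o → suc (l + v + (l + o)) ≡ l + l + suc (o + v)
      shape₂ = solve-∀
      shape₃ : ∀ l e h → l + l + e + h ≡ l + e + h + l
      shape₃ = solve-∀
      shape₄ : ∀ l o v h → l + suc (o + v) + h ≡ l + v + suc (h + o)
      shape₄ = solve-∀
      flip-n : suc (rank (suc j) + rank (suc k)) ≡ n
      flip-n = ℕ.+-cancelʳ-≡ (Lo b) _ _ (begin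
        suc (rank (suc j) + rank (suc k)) + Lo b      ≡⟨ cong (λ x → suc (x + rank (suc k)) + Lo b) (rank-suc≡ j) ⟩
        suc (Hi b + Offset j + rank (suc k)) + Lo b    ≡⟨ cong (suc (Hi b + Offset j + rank (suc k)) +_) (sym (ℕ.+-identityʳ _)) ⟩
        suc (Hi b + Offset j + rank (suc k)) + (Lo b + 0) ≡⟨ shape₁ (Lo b) (Offset j) (Hi b) (rank (suc k)) 0 ⟩
        suc (Lo b + Offset j + rank (suc k)) + (Hi b + 0) ≡⟨ cong₂ (λ x y → suc (x + rank (suc k)) + y) (rank≡Lo+Offset j) (sym (ℕ.+-identityʳ _)) ⟨
        suc (rank j + rank (suc k)) + Hi b             ≡⟨ cong (_+ Hi b) sum ⟩
        Lo b + Lo b + Eq b + Hi b                      ≡⟨ shape₃ (Lo b) (Eq b) (Hi b) ⟩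
        Lo b + Eq b + Hi b + Lo b                      ≡⟨ cong (_+ Lo b) (Lo+Eq+Hi≡n b) ⟩
        n + Lo b                                       ∎)
      rank-j : rank (suc j) ≡ Lo c + v
      rank-j = ℕ.+-cancelʳ-≡ (suc (Hi c + Offset k)) _ _ (begin
        rank (suc j) + suc (Hi c + Offset k)   ≡⟨ ℕ.+-suc (rank (suc j)) _ ⟩
        suc (rank (suc j) + (Hi c + Offset k)) ≡⟨ cong (λ x → suc (rank (suc j) + x)) (rank-suc≡ k) ⟨
        suc (rank (suc j) + rank (suc k))      ≡⟨ flip-n ⟩
        n                                      ≡⟨ Lo+Eq+Hi≡n c ⟨
        Lo c + Eq c + Hi c                     ≡⟨ cong (λ e → Lo c + e + Hi c) eq ⟨
        Lo c + suc (Offset k + v) + Hi c       ≡⟨ shape₄ (Lo c) (Offset k) v (Hi c) ⟩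
        Lo c + v + suc (Hi c + Offset k)       ∎)
      Wj≡c : W (suc j) ≡ c
      Wj≡c = ∈Lo-unique (rank∈Lo (suc j)) (subst (_∈Lo c) (sym rank-j)
        (ℕ.m≤m+n (Lo c) v , ℕ.+-monoʳ-< (Lo c) (subst (v <_) eq (s≤s (ℕ.m≤n+m v (Offset k))))))

    mirrored-+ : ∀ e → Mirrored 0 e → ∀ j k → j + k ≡ e → Mirrored j k
    mirrored-+ e base zero    k refl = base
    mirrored-+ e base (suc j) k eq   = mirrored-suc j k (mirrored-+ e base j (suc k) (trans (ℕ.+-suc j k) eq))

    Start-0 : Start 0
    Start-0 = trans rank0≡0 (sym (ℕ.n≤0⇒n≡0 (subst (Lo (W 0) ≤_) rank0≡0 (proj₁ (rank∈Lo 0)))))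

    Lo-W0≡0 : Lo (W 0) ≡ 0
    Lo-W0≡0 = trans (sym Start-0) rank0≡0

    -- `e` is the index of the last rank of the first block, to which `ι` sends `rank 0`. So letters
    -- agree at indices with sum `e + n`, or `e` by periodicity; this mirrors the first `suc e`
    -- letters and the remaining ones separately.
    productOfPalindromes : ProductOfTwoPalindromes (rot 0)
    productOfPalindromes with complement 0
    ... | v , eq with rank-surjective (ℕ.<-≤-trans (subst (v <_) eq (s≤s (ℕ.m≤n+m v _)))
                        (subst (Eq (W 0) ≤_) (Lo+Eq+Hi≡n (W 0)) (ℕ.m≤n⇒m≤n+o (Hi (W 0)) (ℕ.m≤n+m (Eq (W 0)) (Lo (W 0))))))
    ...   | e , e<n , rank-e = win 0 (suc e) , win (suc e) k ,
              win-palindrome 0 (suc e) first , win-palindrome (suc e) k second ,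
              trans (cong (win 0) (sym e+k≡n)) (win-++ 0 (suc e) k)
      where
      k = n ∸ suc e
      e+k≡n : suc e + k ≡ n
      e+k≡n = ℕ.m+[n∸m]≡n e<n
      offset0 : Offset 0 ≡ 0
      offset0 = ℕ.n≤0⇒n≡0 (subst (Offset 0 ≤_) (trans (sym (rank≡Lo+Offset 0)) rank0≡0) (ℕ.m≤n+m (Offset 0) (Lo (W 0))))
      suc-v≡Eq : suc v ≡ Eq (W 0)
      suc-v≡Eq = trans (cong (λ o → suc (o + v)) (sym offset0)) eq
      We≡W0 : W e ≡ W 0
      We≡W0 = ∈Lo-unique (rank∈Lo e) (subst (_∈Lo W 0) (sym rank-e)
        (subst (_≤ v) (sym Lo-W0≡0) z≤n , subst₂ (λ l E → v < l + E) (sym Lo-W0≡0) suc-v≡Eq (ℕ.n<1+n v)))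
      rot-e : rot (e + n) ≡ rot e
      rot-e = rot-periodic e
      -- Taking `e + n` instead of `e` reaches the second palindrome, whose mirrored indices add up
      -- to `e + n`.
      base : Mirrored 0 (e + n)
      base = trans (sym We≡W0) (sym (periodic e)) , trans
        (cong₂ (λ x y → suc (x + y)) rank0≡0 (trans (rank-cong rot-e) rank-e))
        (trans suc-v≡Eq (cong (λ l → l + l + Eq (W 0)) (sym Lo-W0≡0)))
      first : ∀ j j′ → suc (j + j′) ≡ suc e → W (0 + j) ≡ W (0 + j′)
      first j j′ eq = trans (proj₁ (mirrored-+ (e + n) base j (j′ + n)
        (trans (sym (ℕ.+-assoc j j′ n)) (cong (_+ n) (ℕ.suc-injective eq))))) (periodic j′)
      second : ∀ j j′ → suc (j + j′) ≡ k → W (suc e + j) ≡ W (suc e + j′)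
      second j j′ eq = proj₁ (mirrored-+ (e + n) base (suc e + j) (suc e + j′)
        (trans (shape e j j′) (cong (e +_) (trans (cong (suc e +_) eq) e+k≡n))))
        where
        shape : ∀ e j j′ → suc e + j + (suc e + j′) ≡ e + (suc e + suc (j + j′))
        shape = solve-∀

    -- The palindromic special factorization

    ∈-win⇒Eq>0 : ∀ {c} → c ∈ rot 0 → 0 < Eq c
    ∈-win⇒Eq>0 {c} c∈ with at-win 0 n c∈
      where
      at-win : ∀ i k → c ∈ win i k → ∃ λ j → c ≡ W j
      at-win i (suc k) (here p)   = i , p
      at-win i (suc k) (there c∈) = at-win (suc i) k c∈
    ... | j , refl = ℕ.≤-<-trans z≤n (Offset<Eq j)

    -- Occurring letters are those with `Eq d` positive; the last clause makes the factorization
    -- special once `p` is `0`.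
    Tail : ℕ → ℕ → List (Factor {r}) → Set
    Tail p k rest = win p k ≡ assemble (W p) rest
      × Linked F._<_ (letters (W p) rest)
      × (∀ {π a} → (π , a) ∈ rest → Palindrome π)
      × (∀ {d} → 0 < Eq d → W p F.≤ d → d ∈ letters (W p) rest)

    -- The block of a larger letter starts at `x` or later and, being nonempty, ends beyond `x`.
    ¬skipped : ∀ {a d x} → 0 < Eq d → Lo a + Eq a ≡ x → a F.< d → ¬ Lo d + Eq d ≤ x
    ¬skipped {a} {d} pos refl a<d le = ℕ.<⇒≱ (ℕ.<-≤-trans (ℕ.m<m+n (Lo d) pos) le) (Lo-blocks a<d)

    Start⇒rank-suc : ∀ {p} → Start p → rank (suc p) ≡ Hi (W p)
    Start⇒rank-suc {p} start = trans (rank-suc≡ p) (trans (cong (Hi (W p) +_) offset) (ℕ.+-identityʳ _))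
      where
      offset : Offset p ≡ 0
      offset = ℕ.+-cancelˡ-≡ (Lo (W p)) _ _
        (trans (sym (rank≡Lo+Offset p)) (trans start (sym (ℕ.+-identityʳ _))))

    positive-rank : ∀ {p} → p ≤ n → rank p ≢ 0 → p < n
    positive-rank p≤n ≢0 with ℕ.m≤n⇒m<n∨m≡n p≤n
    ... | inj₁ lt = lt
    ... | inj₂ eq = ⊥-elim (≢0 (trans (cong rank eq) (trans (rank-cong (rot-periodic 0)) rank0≡0)))

    block≤n : ∀ c → Lo c + Eq c ≤ n
    block≤n c = subst (Lo c + Eq c ≤_) (Lo+Eq+Hi≡n c) (ℕ.m≤m+n _ _)

    -- Nothing lies above the last block, so `rank (suc p)`, which is `Hi (W p)`, is `0`. Hence
    -- `suc p` is `0` modulo `n`, and the word ends at `p`.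
    lastBlock : ∀ p k → p + suc k ≡ n → Start p → Lo (W p) + Eq (W p) ≡ n → Tail p (suc k) []
    lastBlock p k p+k≡n start top = cong (W p ∷_) (cong (win (suc p)) k≡0) , [-] , (λ ()) , present
      where
      Hi≡0 : Hi (W p) ≡ 0
      Hi≡0 = ℕ.+-cancelˡ-≡ n _ _ (trans (cong (_+ Hi (W p)) (sym top))
        (trans (Lo+Eq+Hi≡n (W p)) (sym (ℕ.+-identityʳ n))))
      k≡0 : k ≡ 0
      k≡0 with ℕ.m≤n⇒m<n∨m≡n (ℕ.m≤m+n (suc p) k)
      ... | inj₂ eq = ℕ.+-cancelˡ-≡ (suc p) _ _ (trans (sym eq) (sym (ℕ.+-identityʳ _)))
      ... | inj₁ lt = ⊥-elim (ℕ.1+n≢0 (rot-injective 0 {suc p} {0}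
        (subst (suc p <_) (trans (sym (ℕ.+-suc p k)) p+k≡n) lt) (s≤s z≤n)
        (rank-injective {suc p} {0} (trans (Start⇒rank-suc start) (trans Hi≡0 (sym rank0≡0))))))
      present : ∀ {d} → 0 < Eq d → W p F.≤ d → d ∈ W p ∷ []
      present {d} pos b≤d with F.<-cmp (W p) d
      ... | tri≈ _ eq _ = here (sym eq)
      ... | tri> _ _ gt = ⊥-elim (ℕ.<⇒≱ gt b≤d)
      ... | tri< lt _ _ = ⊥-elim (¬skipped pos top lt (block≤n d))

    -- `q` is the index whose rank is the boundary at the right end of the block of `W p`. This
    -- boundary and `rank (suc p)`, which is `Hi (W p)`, add up to `n`, so `Gap` applies to the
    -- letters strictly between `p` and `q`.
    nextBlock : ∀ p → p < n → Start p → Lo (W p) + Eq (W p) < n → ∃₂ λ q J →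
      q < n × Start q × W p F.< W q × Lo (W p) + Eq (W p) ≡ Lo (W q) × q ≡ suc p + J × Palindrome (win (suc p) J)
    nextBlock p p<n start x<n with rank-surjective x<n
    ... | q , q<n , rank-q = q , Gap.J q (suc p) q<n suc-p<n start-q sum₀ , q<n , start-q , b<c , x≡Lo-c ,
          Gap.meets q (suc p) q<n suc-p<n start-q sum₀ ,
          win-palindrome (suc p) _ (Gap.palindromic q (suc p) q<n suc-p<n start-q sum₀)
      where
      x∈Lo-c : (Lo (W p) + Eq (W p)) ∈Lo W q
      x∈Lo-c = subst (_∈Lo W q) rank-q (rank∈Lo q)
      b<c : W p F.< W q
      b<c with F.<-cmp (W p) (W q)
      ... | tri< lt _ _ = lt
      ... | tri≈ _ eq _ = ⊥-elim (ℕ.<-irrefl (cong (λ a → Lo a + Eq a) eq) (proj₂ x∈Lo-c))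
      ... | tri> _ _ gt = ⊥-elim (ℕ.<⇒≱ (proj₂ x∈Lo-c) (ℕ.≤-trans (Lo-blocks gt) (ℕ.m≤m+n _ _)))
      x≡Lo-c : Lo (W p) + Eq (W p) ≡ Lo (W q)
      x≡Lo-c = ℕ.≤-antisym (Lo-blocks b<c) (proj₁ x∈Lo-c)
      start-q : Start q
      start-q = trans rank-q x≡Lo-c
      sum₀ : rank q + rank (suc p) ≡ n
      sum₀ = trans (cong₂ _+_ rank-q (Start⇒rank-suc start)) (Lo+Eq+Hi≡n (W p))
      suc-p<n : suc p < n
      suc-p<n = positive-rank p<n (λ ≡0 → ℕ.<-irrefl
        (trans (sym (ℕ.+-identityʳ _)) (trans (cong (rank q +_) (sym ≡0)) sum₀)) (rank<n q))

    Tail-∷ : ∀ {p q k k′ J rest} → W p F.< W q → Lo (W p) + Eq (W p) ≡ Lo (W q) → q ≡ suc p + J →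
      k ≡ J + k′ → Palindrome (win (suc p) J) → Tail q k′ rest →
      Tail p (suc k) ((win (suc p) J , W q) ∷ rest)
    Tail-∷ {p} {q} {k} {k′} {J} {rest} b<c x≡Lo-c q≡ k≡ pal (eq , linked , pals , present) =
      cong (W p ∷_) (trans split (trans (cong (win (suc p) J ++_) eq) (sym (L.++-assoc (win (suc p) J) _ _)))) ,
      b<c ∷ linked , pals′ , present′
      where
      split : win (suc p) k ≡ win (suc p) J ++ win q k′
      split = trans (cong (win (suc p)) k≡) (trans (win-++ (suc p) J k′)
        (cong (λ i → win (suc p) J ++ win i k′) (sym q≡)))
      pals′ : ∀ {π a} → (π , a) ∈ (win (suc p) J , W q) ∷ rest → Palindrome π
      pals′ (here refl) = pal
      pals′ (there p)   = pals p
      present′ : ∀ {d} → 0 < Eq d → W p F.≤ d → d ∈ W p ∷ letters (W q) rest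
      present′ {d} pos b≤d with F.<-cmp (W p) d
      ... | tri≈ _ eq _ = here (sym eq)
      ... | tri> _ _ gt = ⊥-elim (ℕ.<⇒≱ gt b≤d)
      ... | tri< lt _ _ with W q F.≤? d
      ...   | yes c≤d = there (present pos c≤d)
      -- A letter strictly between `W p` and `W q` would have a nonempty block between two adjacent
      -- ones.
      ...   | no  c≰d = ⊥-elim (¬skipped pos x≡Lo-c lt (Lo-blocks (ℕ.≰⇒> c≰d)))

    prepend : ∀ p k → p + suc k ≡ n →
      (∀ q k′ → k′ < k → q + suc k′ ≡ n → Start q → ∃ λ rest → Tail q (suc k′) rest) →
      (∃₂ λ q J → q < n × Start q × W p F.< W q × Lo (W p) + Eq (W p) ≡ Lo (W q) ×
        q ≡ suc p + J × Palindrome (win (suc p) J)) →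
      ∃ λ rest → Tail p (suc k) rest
    prepend p k p+k≡n rec (q , J , q<n , start-q , b<c , x≡Lo-c , q≡ , pal) =
      (win (suc p) J , W q) ∷ proj₁ tail-q ,
      Tail-∷ {p} {q} {k} {suc k′} {J} {proj₁ tail-q} b<c x≡Lo-c q≡ k≡ pal (proj₂ tail-q)
      where
      k′ : ℕ
      k′ = n ∸ suc q
      q+k′≡n : q + suc k′ ≡ n
      q+k′≡n = trans (ℕ.+-suc q k′) (ℕ.m+[n∸m]≡n q<n)
      k≡ : k ≡ J + suc k′
      k≡ = ℕ.+-cancelˡ-≡ (suc p) k (J + suc k′) (trans (sym (ℕ.+-suc p k)) (trans p+k≡n (trans (sym q+k′≡n)
        (trans (cong (_+ suc k′) q≡) (ℕ.+-assoc (suc p) J (suc k′))))))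
      tail-q : ∃ λ rest → Tail q (suc k′) rest
      tail-q = rec q k′ (subst (suc k′ ≤_) (sym k≡) (ℕ.m≤n+m (suc k′) J)) q+k′≡n start-q

    tail : ∀ p k → Acc _<_ k → p + suc k ≡ n → Start p → ∃ λ rest → Tail p (suc k) rest
    tail p k (acc smaller) p+k≡n start with ℕ.m≤n⇒m<n∨m≡n (block≤n (W p))
    ... | inj₂ top = [] , lastBlock p k p+k≡n start top
    ... | inj₁ x<n = prepend p k p+k≡n (λ q k′ k′<k → tail q k′ (smaller k′<k)) (nextBlock p p<n start x<n)
      where
      p<n : p < n
      p<n = subst (p <_) p+k≡n (ℕ.m<m+n p (s≤s z≤n))

    palindromicSpecialFactorization : HasPalindromicSpecialFactorization (rot 0)
    palindromicSpecialFactorization with tail 0 m (<-wellFounded m) refl Start-0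
    ... | rest , eq , linked , pals , present = W 0 , rest , (eq , linked , λ c → mk⇔ to (from c)) , pals
      where
      to : ∀ {c} → c ∈ rot 0 → c ∈ letters (W 0) rest
      -- A letter below `W 0` would have a nonempty block ending at or before `Lo (W 0)`, which is
      -- `0`.
      to {c} c∈ = present (∈-win⇒Eq>0 c∈) (ℕ.≮⇒≥ λ c<W0 → ℕ.<⇒≱ (∈-win⇒Eq>0 c∈)
        (ℕ.≤-trans (ℕ.m≤n+m (Eq c) (Lo c)) (subst (Lo c + Eq c ≤_) Lo-W0≡0 (Lo-blocks c<W0))))
      from : ∀ c → c ∈ letters (W 0) rest → c ∈ rot 0
      from c c∈ = subst (c ∈_) (sym eq) (letters⊆assemble (W 0) rest c∈)

-- A special factorization reversed by conjugation gives clustering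

module _ {r : ℕ} where

  assemble-∷ : ∀ a π (b : Fin r) rest → assemble a ((π , b) ∷ rest) ≡ a ∷ π ++ assemble b rest
  assemble-∷ a π b rest = cong (a ∷_) (L.++-assoc π [ b ] _)

  reversedW-++ : ∀ (u t : Word r) rest → reversedW (u ++ t) rest ≡ reversedW u rest ++ t
  reversedW-++ u t []               = refl
  reversedW-++ u t ((π , a) ∷ rest) =
    trans (cong (λ x → reversedW (a ∷ x) rest) (sym (L.++-assoc π u t))) (reversedW-++ (a ∷ π ++ u) t rest)

  assembleRev-∷ : ∀ (a : Fin r) π b rest → assembleRev a ((π , b) ∷ rest) ≡ assembleRev b rest ++ π ++ [ a ]
  assembleRev-∷ a π b rest = reversedW-++ [ b ] (π ++ [ a ]) rest

  reverse-assemble : ∀ (a : Fin r) rest → (∀ {π b} → (π , b) ∈ rest → Palindrome π) →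
    reverse (assemble a rest) ≡ assembleRev a rest
  reverse-assemble a []               _    = refl
  reverse-assemble a ((π , b) ∷ rest) pals = begin
    reverse (assemble a ((π , b) ∷ rest))            ≡⟨ cong reverse (assemble-∷ a π b rest) ⟩
    reverse ((a ∷ π) ++ assemble b rest)             ≡⟨ L.reverse-++ (a ∷ π) _ ⟩
    reverse (assemble b rest) ++ reverse (a ∷ π)     ≡⟨ cong₂ _++_ (reverse-assemble b rest (pals ∘ there)) (L.unfold-reverse a π) ⟩
    assembleRev b rest ++ reverse π ++ [ a ]         ≡⟨ cong (λ x → assembleRev b rest ++ x ++ [ a ]) (pals (here refl)) ⟩
    assembleRev b rest ++ π ++ [ a ]                 ≡⟨ assembleRev-∷ a π b rest ⟨
    assembleRev a ((π , b) ∷ rest)                   ∎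
    where open ≡-Reasoning

  -- The reversal of `p ++ q` is its conjugate `q ++ p`, and reversing a palindromic special
  -- factorization only reverses the order of its parts.
  palindromes⇒conjugate : ∀ {w : Word r} → ProductOfTwoPalindromes w → HasPalindromicSpecialFactorization w →
    HasConjugateReversedSpecialFactorization w
  palindromes⇒conjugate {w} (p , q , p-pal , q-pal , w≡pq) (a , rest , special@(w≡ , _) , pals) =
    a , rest , special , p , q , w≡pq , (begin
      assembleRev a rest          ≡⟨ reverse-assemble a rest pals ⟨
      reverse (assemble a rest)   ≡⟨ cong reverse (trans (sym w≡) w≡pq) ⟩
      reverse (p ++ q)            ≡⟨ L.reverse-++ p q ⟩
      reverse q ++ reverse p      ≡⟨ cong₂ _++_ q-pal p-pal ⟩
      q ++ p                      ∎)
    where open ≡-Reasoning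

  tailLength : List (Factor {r}) → ℕ
  tailLength []               = 0
  tailLength ((π , _) ∷ rest) = suc (length π) + tailLength rest

  length-assemble : ∀ (a : Fin r) rest → length (assemble a rest) ≡ suc (tailLength rest)
  length-assemble a []               = refl
  length-assemble a ((π , b) ∷ rest) = trans (cong length (assemble-∷ a π b rest))
    (cong suc (trans (L.length-++ π) (trans (cong (length π +_) (length-assemble b rest)) (ℕ.+-suc (length π) _))))

  -- Position in the reversed word of the i-th letter after a₁: the blocks π_m a_{m+1} are translated
  -- onto the blocks π_m a_m, which occur in the opposite order.
  shift : List (Factor {r}) → ℕ → ℕ
  shift []               i = i
  shift ((π , _) ∷ rest) i with i ℕ.≤? length π
  ... | yes _ = tailLength rest + i
  ... | no  _ = shift rest (i ∸ suc (length π))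

  past : ∀ (π : Word r) rest {i} → i < suc (length π) + tailLength rest → ¬ i ≤ length π →
    i ∸ suc (length π) < tailLength rest
  past π rest {i} i< i≰π = ℕ.+-cancelˡ-< (suc (length π)) _ _
    (subst (_< suc (length π) + tailLength rest) (sym (ℕ.m+[n∸m]≡n (ℕ.≰⇒> i≰π))) i<)

  shift-< : ∀ rest {i} → i < tailLength rest → shift rest i < tailLength rest
  shift-< ((π , _) ∷ rest) {i} i< with i ℕ.≤? length π
  ... | yes i≤π = subst (tailLength rest + i <_) (ℕ.+-comm (tailLength rest) _) (ℕ.+-monoʳ-< (tailLength rest) (s≤s i≤π))
  ... | no  i≰π = ℕ.<-≤-trans (shift-< rest (past π rest i< i≰π)) (ℕ.m≤n+m _ (suc (length π)))

  -- Positions in the first block go to `tailLength rest` or beyond, all others below it, so only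
  -- positions on the same side can collide.
  shift-injective : ∀ rest {i j} → i < tailLength rest → j < tailLength rest →
    shift rest i ≡ shift rest j → i ≡ j
  shift-injective ((π , _) ∷ rest) {i} {j} i< j< eq with i ℕ.≤? length π | j ℕ.≤? length π
  ... | yes _   | yes _   = ℕ.+-cancelˡ-≡ (tailLength rest) _ _ eq
  ... | yes _   | no j≰π  = ⊥-elim (ℕ.<⇒≱ (shift-< rest (past π rest j< j≰π))
                              (subst (tailLength rest ≤_) eq (ℕ.m≤m+n _ i)))
  ... | no i≰π  | yes _   = ⊥-elim (ℕ.<⇒≱ (shift-< rest (past π rest i< i≰π))
                              (subst (tailLength rest ≤_) (sym eq) (ℕ.m≤m+n _ j)))
  ... | no i≰π  | no j≰π  = ℕ.∸-cancelʳ-≡ (ℕ.≰⇒> i≰π) (ℕ.≰⇒> j≰π)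
    (shift-injective rest (past π rest i< i≰π) (past π rest j< j≰π) eq)

  -- The rotation of v that starts just after position i′ is smaller than that of u just after i,
  -- and its preceding letter is at least as large.
  record Descent (u v : Word r) (i i′ : ℕ) : Set where
    field
      {before before′ common after after′} : Word r
      {l l′ large small} : Fin r
      u≡  : u ≡ before  ++ l  ∷ common ++ large ∷ after
      v≡  : v ≡ before′ ++ l′ ∷ common ++ small ∷ after′
      i≡  : length before ≡ i
      i′≡ : length before′ ≡ i′
      small<large : small F.< large
      l≤l′ : l F.≤ l′

  split-at : ∀ (π : Word r) {i} → i < length π → ∃₂ λ x l → ∃ λ p → π ≡ x ++ l ∷ p × length x ≡ i
  split-at (a ∷ π) {zero}  _        = [] , a , π , refl , refl
  split-at (a ∷ π) {suc i} (s≤s lt) with split-at π lt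
  ... | x , l , p , refl , refl = a ∷ x , l , p , refl , refl

  assembleRev-last : ∀ (a : Fin r) rest → ∃ λ x → assembleRev a rest ≡ x ++ [ a ] × length x ≡ tailLength rest
  assembleRev-last a []               = [] , refl , refl
  assembleRev-last a ((π , b) ∷ rest) with assembleRev-last b rest
  ... | x , eq , len = (x ++ [ b ]) ++ π ,
        trans (assembleRev-∷ a π b rest) (trans (cong (_++ π ++ [ a ]) eq) (sym (L.++-assoc (x ++ [ b ]) π [ a ]))) ,
        trans (L.length-++ (x ++ [ b ])) (trans (cong (_+ length π) (trans (L.length-++ x) (cong (_+ 1) len)))
          (shape (tailLength rest) (length π)))
    where
    shape : ∀ t p → t + 1 + p ≡ suc p + t
    shape = solve-∀

  -- Along its first block the word reads `a`, `π`, `b`, and the reversed word, from the translated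
  -- position, `b`, `π`, `a`. After a common suffix of `π`, `b` meets the smaller `a`; before that
  -- suffix stand `a` and `b`, or the same letter of `π` twice.
  descent : ∀ (a : Fin r) rest → Linked F._<_ (letters a rest) → ∀ {i} → i < tailLength rest →
    Descent (assemble a rest) (assembleRev a rest) i (shift rest i)
  descent a ((π , b) ∷ rest) (a<b ∷ linked) {i} i< with i ℕ.≤? length π
  descent a ((π , b) ∷ rest) (a<b ∷ linked) {zero} i< | yes _ with assembleRev-last b rest
  ... | x , eq , len = record
    { before = [] ; before′ = x ; common = π ; l = a ; l′ = b
    ; u≡ = assemble-∷ a π b rest
    ; v≡ = trans (assembleRev-∷ a π b rest) (trans (cong (_++ π ++ [ a ]) eq) (L.++-assoc x [ b ] _))
    ; i≡ = refl ; i′≡ = trans len (sym (ℕ.+-identityʳ _)) ; small<large = a<b ; l≤l′ = ℕ.<⇒≤ a<b }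
  descent a ((π , b) ∷ rest) (a<b ∷ linked) {suc i} i< | yes i<π with split-at π i<π
  ... | x , l , p , refl , refl = record
    { before = a ∷ x ; before′ = assembleRev b rest ++ x ; common = p ; l = l ; l′ = l
    ; u≡ = trans (assemble-∷ a π b rest) (cong (a ∷_) (L.++-assoc x (l ∷ p) _))
    ; v≡ = trans (assembleRev-∷ a π b rest) (trans (cong (assembleRev b rest ++_) (L.++-assoc x (l ∷ p) [ a ]))
        (sym (L.++-assoc (assembleRev b rest) x _)))
    ; i≡ = refl
    ; i′≡ = trans (L.length-++ (assembleRev b rest)) (trans (cong (_+ length x) len)
        (sym (ℕ.+-suc (tailLength rest) (length x))))
    ; small<large = a<b ; l≤l′ = ℕ.≤-refl }
    where
    len : length (assembleRev b rest) ≡ suc (tailLength rest)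
    len with assembleRev-last b rest
    ... | y , eq , len = trans (cong length eq) (trans (L.length-++ y) (trans (ℕ.+-comm (length y) 1) (cong suc len)))
  descent a ((π , b) ∷ rest) (a<b ∷ linked) {i} i< | no i≰π = record
    { before = a ∷ π ++ before ; before′ = before′
    ; u≡ = trans (assemble-∷ a π b rest) (cong (a ∷_) (trans (cong (π ++_) u≡) (sym (L.++-assoc π before _))))
    ; v≡ = trans (assembleRev-∷ a π b rest) (trans (cong (_++ π ++ [ a ]) v≡)
        (trans (L.++-assoc before′ _ _) (cong (λ x → before′ ++ _ ∷ x) (L.++-assoc common _ _))))
    ; i≡ = trans (cong suc (L.length-++ π)) (trans (cong (suc (length π) +_) i≡) (ℕ.m+[n∸m]≡n (ℕ.≰⇒> i≰π)))
    ; i′≡ = i′≡ ; small<large = small<large ; l≤l′ = l≤l′ }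
    where open Descent (descent b rest linked (past π rest i< i≰π))

  lastOr-++-∷ : ∀ d x (l : Fin r) y → lastOr d (x ++ l ∷ y) ≡ lastOr l y
  lastOr-++-∷ d []      l y = refl
  lastOr-++-∷ d (a ∷ x) l y = lastOr-++-∷ a x l y

  <lex-++ : ∀ (p : Word r) {u v} → u <lex v → (p ++ u) <lex (p ++ v)
  <lex-++ []      lt = lt
  <lex-++ (a ∷ p) lt = there (<lex-++ p lt)

-- The predecessor map on ranks

module SpecialConjugate {r : ℕ} (m : ℕ) (W : ℕ → Fin r) (periodic : ∀ i → W (i + suc m) ≡ W i) where

  open Cyclic m W periodic

  lastOr-rot : ∀ d j → lastOr d (rot (suc j)) ≡ W j
  lastOr-rot d j = trans (cong (lastOr d) (rot-suc j)) (lastOr-++-∷ d (win (suc j) m) (W j) [])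

  rot-suc≡⇒W≡ : ∀ {i j} → rot (suc i) ≡ rot (suc j) → W i ≡ W j
  rot-suc≡⇒W≡ {i} {j} eq = trans (sym (lastOr-rot (W 0) i)) (trans (cong (lastOr (W 0)) eq) (lastOr-rot (W 0) j))

  rot-after : ∀ h {x l y} → rot h ≡ x ++ l ∷ y → y ++ x ++ [ l ] ≡ rot (suc (h + length x))
  rot-after h {x} {l} {y} eq = trans (rot-conjugate h (x ++ [ l ]) (trans (L.++-assoc x [ l ] y) (sym eq)))
    (cong rot (trans (cong (h +_) (trans (L.length-++ x) (ℕ.+-comm (length x) 1))) (ℕ.+-suc h (length x))))

  letter-at : ∀ h {x l y} → rot h ≡ x ++ l ∷ y → W (h + length x) ≡ l
  letter-at h {x} {l} {y} eq = trans (sym (lastOr-rot l (h + length x)))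
    (trans (cong (lastOr l) (sym (rot-after h eq)))
      (trans (cong (lastOr l) (sym (L.++-assoc y x [ l ]))) (lastOr-++-∷ l (y ++ x) l [])))

  module _ (prim : Primitive (rot 0)) (a : Fin r) (rest : List Factor)
    (linked : Linked F._<_ (letters a rest)) (rot0≡ : rot 0 ≡ assemble a rest)
    (h : ℕ) (roth≡ : rot h ≡ assembleRev a rest) where

    open Aperiodic prim

    tailLength≡m : tailLength rest ≡ m
    tailLength≡m = ℕ.suc-injective (trans (sym (length-assemble a rest))
      (trans (cong length (sym rot0≡)) (length-win 0 n)))

    -- `shift` gives a position in the reversed word, which is `rot h`; adding `h` makes it an index
    -- of `W`.
    lower : ℕ → ℕ
    lower i = h + shift rest i

    lower-descends : ∀ {i} → i < m → rot (suc (lower i)) <lex rot (suc i) × W i F.≤ W (lower i)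
    lower-descends {i} i<m = subst₂ _<lex_ (rot-at′ ) rot-at
        (subst₂ _<lex_ (sym (L.++-assoc common _ _)) (sym (L.++-assoc common _ _)) (<lex-++ common (here small<large))) ,
      subst₂ F._≤_ (trans (sym (letter-at 0 eq)) (cong W i≡))
        (trans (sym (letter-at h eq′)) (cong (λ k → W (h + k)) i′≡)) l≤l′
      where
      open Descent (descent a rest linked (subst (i <_) (sym tailLength≡m) i<m))
      eq = trans rot0≡ u≡
      eq′ = trans roth≡ v≡
      rot-at : (common ++ large ∷ after) ++ before ++ [ l ] ≡ rot (suc i)
      rot-at = trans (rot-after 0 eq) (cong (rot ∘ suc) i≡)
      rot-at′ : (common ++ small ∷ after′) ++ before′ ++ [ l′ ] ≡ rot (suc (lower i))
      rot-at′ = trans (rot-after h eq′) (cong (λ k → rot (suc (h + k))) i′≡)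

    lower-rank-< : ∀ {i} → i < m → rank (suc (lower i)) < rank (suc i)
    lower-rank-< i<m = rank-mono (proj₁ (lower-descends i<m))

    lower-rank-injective : ∀ {i j} → i < m → j < m → rank (suc (lower i)) ≡ rank (suc (lower j)) → i ≡ j
    lower-rank-injective {i} {j} i<m j<m eq = shift-injective rest i<t j<t
      (ℕ.suc-injective (rot-injective h (s≤s (bound i<t)) (s≤s (bound j<t))
        (subst₂ (λ x y → rot x ≡ rot y) (sym (ℕ.+-suc h (shift rest i))) (sym (ℕ.+-suc h (shift rest j)))
          (rank-injective {suc (lower i)} {suc (lower j)} eq))))
      where
      i<t = subst (i <_) (sym tailLength≡m) i<m
      j<t = subst (j <_) (sym tailLength≡m) j<m
      bound : ∀ {i} → i < tailLength rest → shift rest i < m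
      bound {i} i<t = subst (shift rest i <_) tailLength≡m (shift-< rest i<t)

    -- Every `rot (suc i)` with `i < m` has a smaller rotation, so none of them is the least.
    rank0≡0 : rank 0 ≡ 0
    rank0≡0 with rank-surjective (s≤s z≤n)
    ... | zero  , _       , eq = eq
    ... | suc i , s≤s i<m , eq = ⊥-elim (ℕ.n≮0 (subst (rank (suc (lower i)) <_) eq (lower-rank-< i<m)))

    position : ∀ {x} → suc x < n → ∃ λ i → i < m × rank (suc i) ≡ suc x
    position x<n with rank-surjective x<n
    ... | zero  , _       , eq with () ← trans (sym rank0≡0) eq
    ... | suc i , s≤s i<m , eq = i , i<m , eq

    -- An injective map on ranks that decreases every positive rank is the predecessor map.
    lower-rank : ∀ x → Acc _<_ x → ∀ {i} → i < m → rank (suc i) ≡ suc x → rank (suc (lower i)) ≡ x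
    lower-rank x (acc rs) {i} i<m eq
      with ℕ.m≤n⇒m<n∨m≡n (ℕ.≤-pred (subst (rank (suc (lower i)) <_) eq (lower-rank-< i<m)))
    ... | inj₂ y≡x = y≡x
    -- If the image has a rank `y` below `x`, the index of rank `suc y` is also sent to rank `y` by
    -- induction; injectivity identifies it with `i`, so `y` is `x`.
    ... | inj₁ y<x = ⊥-elim (clash (position (ℕ.<-≤-trans (s≤s y<x) (subst (_≤ n) eq (ℕ.<⇒≤ (rank<n (suc i)))))))
      where
      clash : ¬ (∃ λ j → j < m × rank (suc j) ≡ suc (rank (suc (lower i))))
      clash (j , j<m , eq′) = ℕ.<-irrefl
        (ℕ.suc-injective (trans (sym eq′) (trans (cong (rank ∘ suc) j≡i) eq))) y<x
        where
        j≡i : j ≡ i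
        j≡i = lower-rank-injective j<m i<m (lower-rank _ (rs y<x) j<m eq′)

    -- On the way down from `rank (suc j)` to `rank (suc i)`, each predecessor step weakly raises
    -- the preceding letter.
    antitone-≡ : ∀ d i j → rank (suc j) ≡ rank (suc i) + d → W j F.≤ W i
    antitone-≡ zero i j eq = ℕ.≤-reflexive (cong F.toℕ (rot-suc≡⇒W≡ {j} {i}
      (rank-injective {suc j} {suc i} (trans eq (ℕ.+-identityʳ _)))))
    antitone-≡ (suc d) i j eq with position (subst (_< n) eq′ (rank<n (suc j)))
      where
      eq′ = trans eq (ℕ.+-suc (rank (suc i)) d)
    ... | k , k<m , eq-k = ℕ.≤-trans
      (ℕ.≤-reflexive (cong F.toℕ (rot-suc≡⇒W≡ {j} {k} (rank-injective {suc j} {suc k}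
        (trans eq (trans (ℕ.+-suc (rank (suc i)) d) (sym eq-k)))))))
      (ℕ.≤-trans (proj₂ (lower-descends k<m))
        (antitone-≡ d i (lower k) (lower-rank _ (<-wellFounded _) k<m eq-k)))

    antitone : ∀ {i j} → rot (suc i) <lex rot (suc j) → W j F.≤ W i
    antitone {i} {j} lt = antitone-≡ (rank (suc j) ∸ rank (suc i)) i j
      (sym (ℕ.m+[n∸m]≡n (ℕ.<⇒≤ (rank-mono {suc i} {suc j} lt))))

-- The equivalence for a periodic sequence

module Equivalence {r : ℕ} (m : ℕ) (W : ℕ → Fin r) (periodic : ∀ i → W (i + suc m) ≡ W i) where

  open Cyclic m W periodic
  open SpecialConjugate m W periodic using (lastOr-rot)

  ∈-rotations : ∀ j → rot j ∈ rotations (rot 0)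
  ∈-rotations j = subst₂ _∈_ (rot-% j) (sym rotations-rot) (∈-applyUpTo⁺ rot (ℕ.m%n<n j n))

  rotations-∈ : ∀ {u} → u ∈ rotations (rot 0) → ∃ λ j → u ≡ rot (suc j)
  rotations-∈ {u} u∈ with ∈-applyUpTo⁻ rot (subst (u ∈_) rotations-rot u∈)
  -- The form `suc j` exposes the last letter as `W j`; adding a period avoids the predecessor of
  -- `0`.
  ... | i , _ , eq = i + m , trans eq (trans (sym (rot-periodic i)) (cong rot (ℕ.+-suc i m)))

  nonempty : All (_≢ []) (rotations (rot 0))
  nonempty = subst (All (_≢ [])) (sym rotations-rot) (All.applyUpTo⁺₂ rot n (λ _ ()))

  -- The last letter of a rotation is the letter before its starting index, so the last letters
  -- spell the word rotated by one.
  lasts↭ : map (lastOr (W 0)) (rotations (rot 0)) ↭ rot 0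
  lasts↭ = ↭-trans (↭-reflexive lasts≡) (↭-trans (↭.++-comm [ W m ] (win 0 m)) (↭-reflexive rot0≡))
    where
    lasts≡ : map (lastOr (W 0)) (rotations (rot 0)) ≡ [ W m ] ++ win 0 m
    lasts≡ = trans (cong (map (lastOr (W 0))) rotations-rot) (trans (L.map-applyUpTo rot (lastOr (W 0)) n)
      (cong₂ _∷_ (trans (cong (lastOr (W 0)) (sym (rot-periodic 0))) (lastOr-rot (W 0) m))
        (trans (applyUpTo-cong m (λ {i} _ → lastOr-rot (W 0) i)) (sym (win≡applyUpTo 0 m)))))
    rot0≡ : win 0 m ++ [ W m ] ≡ rot 0
    rot0≡ = trans (sym (win-++ 0 m 1)) (cong (win 0) (ℕ.+-comm m 1))

  open Clustering (W 0) (rot 0) nonempty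

  Antitone : Set
  Antitone = ∀ {i j} → rot (suc i) <lex rot (suc j) → W j F.≤ W i

  clustering⇒antitone : PerfectlyClustering (rot 0) → Antitone
  clustering⇒antitone (_ , canonical) {i} {j} lt = subst₂ F._≤_ (lastOr-rot (W 0) j) (lastOr-rot (W 0) i)
    (bw⇒antitone canonical (∈-rotations (suc i)) (∈-rotations (suc j)) lt)

  antitone⇒clustering : Primitive (rot 0) → Antitone → PerfectlyClustering (rot 0)
  antitone⇒clustering prim antitone = prim , antitone⇒bw lasts↭ step
    where
    step : ∀ {u v} → u ∈ rotations (rot 0) → v ∈ rotations (rot 0) → u <lex v →
      lastOr (W 0) v F.≤ lastOr (W 0) u
    step u∈ v∈ lt with rotations-∈ u∈ | rotations-∈ v∈
    ... | i , refl | j , refl = subst₂ F._≤_ (sym (lastOr-rot (W 0) j)) (sym (lastOr-rot (W 0) i)) (antitone {i} {j} lt)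

  lyndon⇒rank0≡0 : Lyndon (rot 0) → rank 0 ≡ 0
  lyndon⇒rank0≡0 (prim , least) with Aperiodic.rank-surjective prim (s≤s z≤n)
  ... | zero  , _   , eq = eq
  ... | suc i , i<n , eq = ⊥-elim (ℕ.n≮0 (subst (rank 0 <_) eq
    (rank-mono (least (rot (suc i)) conj (λ same → ℕ.1+n≢0 (Aperiodic.rot0-injective prim i<n (sym same)))))))
    where
    conj : Conjugate (rot 0) (rot (suc i))
    conj = win 0 (suc i) , win (suc i) (n ∸ suc i) , rot0-cut (ℕ.<⇒≤ i<n) , rot-cut (ℕ.<⇒≤ i<n)

  rank0≡0⇒lyndon : Primitive (rot 0) → rank 0 ≡ 0 → Lyndon (rot 0)
  rank0≡0⇒lyndon prim rank0≡0 = prim , least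
    where
    least : ∀ v → Conjugate (rot 0) v → v ≢ rot 0 → rot 0 <lex v
    least v (x , y , eq , refl) v≢ with <lex-connected (rot 0) (y ++ x)
    ... | inj₁ same      = ⊥-elim (v≢ (sym same))
    ... | inj₂ (inj₁ lt) = lt
    ... | inj₂ (inj₂ gt) = ⊥-elim (ℕ.n≮0 (subst (rank (length x) <_) rank0≡0
      (rank-mono (subst (_<lex rot 0) (rot-conjugate 0 x (sym eq)) gt))))

  clustering⇒palindromes : Lyndon (rot 0) × PerfectlyClustering (rot 0) →
    ProductOfTwoPalindromes (rot 0) × HasPalindromicSpecialFactorization (rot 0)
  clustering⇒palindromes (lyndon@(prim , _) , pc) = productOfPalindromes prim antitone rank0≡0 ,
    palindromicSpecialFactorization prim antitone rank0≡0
    where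
    open SymmetricExchange m W periodic
    antitone = clustering⇒antitone pc
    rank0≡0 = lyndon⇒rank0≡0 lyndon

  conjugate⇒clustering : Primitive (rot 0) → HasConjugateReversedSpecialFactorization (rot 0) →
    Lyndon (rot 0) × PerfectlyClustering (rot 0)
  conjugate⇒clustering prim (a , rest , (rot0≡ , linked , _) , x , y , eq , rev≡) =
    rank0≡0⇒lyndon prim (rank0≡0 prim a rest linked rot0≡ h roth≡) ,
    antitone⇒clustering prim (antitone prim a rest linked rot0≡ h roth≡)
    where
    open SpecialConjugate m W periodic
    h = length x
    roth≡ : rot h ≡ assembleRev a rest
    roth≡ = trans (sym (rot-conjugate 0 x (sym eq))) (sym rev≡)

  equivalences : Primitive (rot 0) →
    ((Lyndon (rot 0) × PerfectlyClustering (rot 0))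
       ⇔ (ProductOfTwoPalindromes (rot 0) × HasPalindromicSpecialFactorization (rot 0)))
    × ((Lyndon (rot 0) × PerfectlyClustering (rot 0)) ⇔ HasConjugateReversedSpecialFactorization (rot 0))
  equivalences prim =
    mk⇔ clustering⇒palindromes (conjugate⇒clustering prim ∘ conjugate) ,
    mk⇔ (conjugate ∘ clustering⇒palindromes) (conjugate⇒clustering prim)
    where
    conjugate : ProductOfTwoPalindromes (rot 0) × HasPalindromicSpecialFactorization (rot 0) →
      HasConjugateReversedSpecialFactorization (rot 0)
    conjugate (product , factorization) = palindromes⇒conjugate product factorization

-- Periodic extension of a nonempty word

module Periodic {r : ℕ} (a : Fin r) (t : Word r) where

  -- The default `a` never enters `W`, whose indices are reduced modulo the length.
  letterAt : Word r → ℕ → Fin r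
  letterAt []      _       = a
  letterAt (x ∷ _) zero    = x
  letterAt (_ ∷ u) (suc i) = letterAt u i

  applyUpTo-letterAt : ∀ u → applyUpTo (letterAt u) (length u) ≡ u
  applyUpTo-letterAt []      = refl
  applyUpTo-letterAt (x ∷ u) = cong (x ∷_) (applyUpTo-letterAt u)

  n = suc (length t)

  W : ℕ → Fin r
  W i = letterAt (a ∷ t) (i % n)

  periodic : ∀ i → W (i + n) ≡ W i
  periodic i = cong (letterAt (a ∷ t)) (ℕ.[m+n]%n≡m%n i n)

  open Cyclic (length t) W periodic using (rot; win≡applyUpTo)

  rot0≡ : rot 0 ≡ a ∷ t
  rot0≡ = trans (win≡applyUpTo 0 n) (trans
    (applyUpTo-cong n (λ i<n → cong (letterAt (a ∷ t)) (ℕ.m<n⇒m%n≡m i<n))) (applyUpTo-letterAt (a ∷ t)))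

theorem4 : (r : ℕ) (w : Word r) → Primitive w →
    ((Lyndon w × PerfectlyClustering w)
    ⇔ (ProductOfTwoPalindromes w × HasPalindromicSpecialFactorization w))
    × ((Lyndon w × PerfectlyClustering w) ⇔ HasConjugateReversedSpecialFactorization w)
-- The empty word is its own square, hence not primitive.
theorem4 r []      prim = ⊥-elim (prim ([] , 2 , s≤s (s≤s z≤n) , refl))
theorem4 r (a ∷ t) = subst (λ w → Primitive w →
    ((Lyndon w × PerfectlyClustering w)
    ⇔ (ProductOfTwoPalindromes w × HasPalindromicSpecialFactorization w))
    × ((Lyndon w × PerfectlyClustering w) ⇔ HasConjugateReversedSpecialFactorization w))
  (Periodic.rot0≡ a t) (Equivalence.equivalences (length t) (Periodic.W a t) (Periodic.periodic a t))
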